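{- Let $d,c,n$ be positive integers with $d\geq 4c$ and $d\mid n$. Then $$m(n,2^{d-1}-c)=\frac{n}{d}\left(2^d-c\right).$$
   Context: For a finite set $V$, a family $\mathcal{F}\subseteq 2^V$ and $T\subseteq V$, the trace of $\mathcal{F}$ on $T$ is $\mathcal{F}_{|T}=\{F\cap T: F\in\mathcal{F}\}$. For integers $n,m,a,b$ write $(n,m)\rightarrow(a,b)$ if for every $n$-element set $V$ and every family $\mathcal{F}\subseteq 2^V$ with $|\mathcal{F}|\geq m$ there is an $a$-element set $T\subseteq V$ with $|\mathcal{F}_{|T}|\geq b$. For non-negative integers $n$ and $s$, $m(n,s)$ denotes the maximum value such that for every $m\leq m(n,s)$ we have $(n,m)\rightarrow(n-1,m-s)$. Equivalently, $m(n,s)$ is the largest number such that every family $\mathcal{H}$ of subsets of an $n$-set $V$ with at most $m(n,s)$ members has a vertex $x$ with $|\{H\setminus\{x\}:H\in\mathcal{H}\}|\geq|\mathcal{H}|-s$. -}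

module Defs where

open import Data.Nat using (ℕ; _≤_; _≥_; _∸_; suc)
open import Data.Bool using (Bool)
open import Data.Bool.Properties renaming (_≟_ to _≟ᵇ_)
open import Data.Fin.Subset using (Subset; _∩_; ∣_∣)
open import Data.Vec.Properties using (≡-dec)
open import Data.List using (List; length; map; deduplicate)
open import Data.List.Relation.Unary.Unique.Propositional using (Unique)
open import Data.Product using (Σ; _×_)
open import Relation.Binary.PropositionalEquality using (_≡_)
open import Relation.Nullary using (¬_)

-- Ground set V = Fin n; subsets of V are 'Subset n'.
-- A family F ⊆ 2^V is a duplicate-free list of subsets; |F| = its length.
_≟ₛ_ : ∀ {n} → (A B : Subset n) → Relation.Nullary.Dec (A ≡ B)
_≟ₛ_ = ≡-dec _≟ᵇ_

trace : ∀ {n} → List (Subset n) → Subset n → List (Subset n)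
trace F T = deduplicate _≟ₛ_ (map (_∩ T) F)

Arrow : ℕ → ℕ → ℕ → ℕ → Set
Arrow n m a b =
  (F : List (Subset n)) → Unique F → length F ≥ m →
  Σ (Subset n) (λ T → (∣ T ∣ ≡ a) × (length (trace F T) ≥ b))

-- The property "(n,m) → (n-1, m-s)" (truncated subtraction: for m ≤ s the
-- target b = 0 is trivially attained, matching the integer reading).
Good : ℕ → ℕ → ℕ → Set
Good n s m = Arrow n m (n ∸ 1) (m ∸ s)

IsMNS : ℕ → ℕ → ℕ → Set
IsMNS n s M = ((m : ℕ) → m ≤ M → Good n s m) × ¬ ((m : ℕ) → m ≤ suc M → Good n s m)

{-# OPTIONS --safe #-}
module Submission where

-- Write c = e + 1 and d = k + 1.  Down-compression preserves |F| and does not decrease the loss at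
-- any vertex, and in a down-closed family the loss at v is the degree of v.  So the lower bound
-- says that a down-closed G with all degrees ≥ 2 ^ k − e has more than (n / d) (2 ^ d − c) members.
-- Every nonempty H ∈ G gives 1 / |H| to each of its vertices, and it must be shown that a vertex
-- gets (2 ^ d − c) / d on average.  Let N v be the closed neighbourhood of v in G; always
-- |N v| ≥ d.  If |N v| = d ("small"), then at most e of the sets H with v ∈ H ⊆ N v are missing
-- from G, and all missing subsets of N v have at least d − e elements; v may fall slightly short,
-- which is repaired by transfers inside N v.  If |N v| > d ("big") and v has a small neighbour x,
-- then G contains nearly all subsets of N x, and the pairs {v , u} with u ∉ N x give a surplus
-- that covers the transfers; here d ≥ 4 c is used.  If a big v has no small neighbour, Katona's
-- bound for the rank weight of a down-closed family of given size applies to the link of v.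
-- For the upper bound, take the union over n / d disjoint d-sets of all their subsets except e
-- singletons each.

open import Defs
open import Data.Bool using (Bool; true; false; if_then_else_; _∧_; _∨_; not; T)
open import Data.Bool.Properties using (T?)
open import Data.Fin using (Fin; zero; suc; _↑ˡ_; _↑ʳ_; splitAt)
import Data.Fin.Properties as Fin
open import Data.Fin.Subset
open import Data.Fin.Subset.Properties
open import Data.List.Base using (List; _∷_; []; _++_; map; length; filter; deduplicate)
  renaming (take to takeˡ)
import Data.List.Membership.DecPropositional as DecMembership
open import Data.List.Membership.Propositional using () renaming (_∈_ to _∈ˡ_)
open import Data.List.Membership.Propositional.Properties
  using (∈-map⁺; ∈-map⁻; ∈-++⁺ˡ; ∈-++⁺ʳ; ∈-filter⁺; ∈-filter⁻; ∈-deduplicate⁺; ∈-deduplicate⁻)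
open import Data.List.Properties using (length-take) renaming (take++drop≡id to takeˡ++dropˡ≡id)
import Data.List.Relation.Unary.All as All
open import Data.List.Relation.Unary.AllPairs using ([]; _∷_)
open import Data.List.Relation.Unary.Any using (here; there)
import Data.List.Relation.Unary.Unique.DecPropositional.Properties as DecUnique
open import Data.List.Relation.Unary.Unique.Propositional using (Unique)
open import Data.List.Relation.Unary.Unique.Propositional.Properties using (take⁺)
open import Data.Nat hiding (parity)
open import Data.Nat.DivMod using (m*n/n≡m; m*[n/m]≡n; m/n≤m; /-monoʳ-≤)
open import Data.Nat.Divisibility using (_∣_; divides; ∣-trans; m∣m*n; m≤n⇒m!∣n!)
open import Data.Nat.Properties
open import Data.Nat.Tactic.RingSolver using (solve-∀)
open import Data.Product using (_×_; _,_; proj₁; proj₂; ∃)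
open import Data.Sum using (_⊎_; inj₁; inj₂; [_,_]′)
open import Data.Unit using (tt)
open import Data.Vec.Base using (_∷_; []; here; there; tabulate; take; drop) renaming (_++_ to _++ᵛ_)
open import Data.Vec.Properties
  using (lookup∘tabulate; []=⇒lookup; lookup⇒[]=; take++drop≡id; ++-injectiveˡ; ++-injectiveʳ)
open import Function using (_∘_)
open import Relation.Binary.PropositionalEquality
open import Relation.Nullary
open import Relation.Nullary.Decidable using (toSum)

-- To stay in the integers, all weights are multiplied by `d * d !`: a vertex gets `d * q s` from a
-- set of size `s`, where `q s = d ! / s`, and has to reach `τ = κ * (2 ^ d - c)` with `κ = d !`. If
-- all sets through `v` inside a `d`-element neighbourhood were present, `v` would get exactly
-- `τ + κ * e`, so it can afford `κ` for each of `e` missing sets. A missing set of size `s < d`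
-- costs more, namely `κ + (d - s) * q s`; this is how a small vertex falls short. The same set
-- costs nothing to the `d - s` vertices of the neighbourhood outside it, and each of them thereby
-- saves `κ = s * q s`. Total deficit and total saving are both `s * (d - s) * q s`, so paying `q s`
-- from each outsider to each member settles the account exactly. The outsiders have this allowance
-- to spare only while at most `e` sets are missing altogether. Beyond that, `D` without `u` must be
-- missing for every small `u` in `D`; hence at most `e + 1` vertices of `D` are small, and the big
-- ones can be made to pay.

private
  variable
    A B : Set
    P Q : Set
    n : ℕ

-- Guarded terms and finite sums

infixr 6 _▸_
-- Sums always run over all subsets or all vertices and are restricted by such a guard, so a double
-- count is an exchange of two fixed sums. Testing only `does` lets guards on `inside ∷ H` and
-- `outside ∷ H` reduce by computation.
_▸_ : Dec P → ℕ → ℕ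
p ▸ x = if does p then x else 0

▸-yes : (p : Dec P) {x : ℕ} → P → p ▸ x ≡ x
▸-yes (yes _) _ = refl
▸-yes (no ¬p) p = contradiction p ¬p

▸-no : (p : Dec P) {x : ℕ} → ¬ P → p ▸ x ≡ 0
▸-no (yes p) ¬p = contradiction p ¬p
▸-no (no _) _ = refl

▸-≤ : (p : Dec P) {x y : ℕ} → (P → x ≤ y) → p ▸ x ≤ y
▸-≤ (yes p) f = f p
▸-≤ (no _) f = z≤n

▸-mono : (p : Dec P) (q : Dec Q) {x y : ℕ} → (P → Q) → (P → x ≤ y) → p ▸ x ≤ q ▸ y
▸-mono p q f g = ▸-≤ p λ h → ≤-trans (g h) (≤-reflexive (sym (▸-yes q (f h))))

▸-cong : (p : Dec P) (q : Dec Q) {x y : ℕ} → (P → Q) → (Q → P) → (P → x ≡ y) → p ▸ x ≡ q ▸ y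
▸-cong (yes p) q f g h = trans (h p) (sym (▸-yes q (f p)))
▸-cong (no ¬p) q f g h = sym (▸-no q (¬p ∘ g))

▸-*ˡ : (p : Dec P) (c : ℕ) {x : ℕ} → c * (p ▸ x) ≡ p ▸ (c * x)
▸-*ˡ (yes _) c = refl
▸-*ˡ (no _) c = *-zeroʳ c

▸-+ : (p : Dec P) {x y : ℕ} → p ▸ (x + y) ≡ (p ▸ x) + (p ▸ y)
▸-+ (yes _) = refl
▸-+ (no _) = refl

▸-split : (p : Dec P) (q : Dec Q) {x : ℕ} →
  p ▸ x ≡ ((p ×-dec q) ▸ x) + ((p ×-dec ¬? q) ▸ x)
▸-split (yes _) (yes _) = sym (+-identityʳ _)
▸-split (yes _) (no _) = refl
▸-split (no _) q = refl

▸-comm : (p : Dec P) (q : Dec Q) {x : ℕ} → p ▸ q ▸ x ≡ q ▸ p ▸ x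
▸-comm (yes _) q = refl
▸-comm (no _) (yes _) = refl
▸-comm (no _) (no _) = refl

▸-× : (p : Dec P) (q : Dec Q) {x : ℕ} → p ▸ q ▸ x ≡ (p ×-dec q) ▸ x
▸-× (yes _) q = refl
▸-× (no _) q = refl

∑ : List A → (A → ℕ) → ℕ
∑ [] f = 0
∑ (x ∷ l) f = f x + ∑ l f

∑-cong : (l : List A) {f g : A → ℕ} → (∀ x → f x ≡ g x) → ∑ l f ≡ ∑ l g
∑-cong [] h = refl
∑-cong (x ∷ l) h = cong₂ _+_ (h x) (∑-cong l h)

∑-mono : (l : List A) {f g : A → ℕ} → (∀ x → f x ≤ g x) → ∑ l f ≤ ∑ l g
∑-mono [] h = z≤n
∑-mono (x ∷ l) h = +-mono-≤ (h x) (∑-mono l h)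

∑-zero : (l : List A) → ∑ l (λ _ → 0) ≡ 0
∑-zero [] = refl
∑-zero (x ∷ l) = ∑-zero l

∑-+ : (l : List A) (f g : A → ℕ) → ∑ l (λ x → f x + g x) ≡ ∑ l f + ∑ l g
∑-+ [] f g = refl
∑-+ (x ∷ l) f g rewrite ∑-+ l f g = lemma (f x) (g x) (∑ l f) (∑ l g)
  where
  lemma : ∀ a b c d → a + b + (c + d) ≡ a + c + (b + d)
  lemma = solve-∀

∑-*ˡ : (l : List A) (c : ℕ) (f : A → ℕ) → ∑ l (λ x → c * f x) ≡ c * ∑ l f
∑-*ˡ [] c f = sym (*-zeroʳ c)
∑-*ˡ (x ∷ l) c f rewrite ∑-*ˡ l c f = sym (*-distribˡ-+ c (f x) (∑ l f))

∑-swap : (l : List A) (m : List B) (f : A → B → ℕ) →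
  ∑ l (λ x → ∑ m (f x)) ≡ ∑ m (λ y → ∑ l (λ x → f x y))
∑-swap [] m f = sym (∑-zero m)
∑-swap (x ∷ l) m f rewrite ∑-swap l m f = sym (∑-+ m (f x) (λ y → ∑ l (λ z → f z y)))

∑-▸ : (l : List A) (p : Dec P) (f : A → ℕ) → ∑ l (λ x → p ▸ f x) ≡ p ▸ ∑ l f
∑-▸ l (yes _) f = refl
∑-▸ l (no _) f = ∑-zero l

∑-++ : (l m : List A) (f : A → ℕ) → ∑ (l ++ m) f ≡ ∑ l f + ∑ m f
∑-++ [] m f = refl
∑-++ (x ∷ l) m f rewrite ∑-++ l m f = sym (+-assoc (f x) _ _)

∑-map : (h : B → A) (l : List B) (f : A → ℕ) → ∑ (map h l) f ≡ ∑ l (f ∘ h)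
∑-map h [] f = refl
∑-map h (x ∷ l) f = cong (f (h x) +_) (∑-map h l f)

∑-∈ : {l : List A} {x : A} (f : A → ℕ) → x ∈ˡ l → f x ≤ ∑ l f
∑-∈ f (here refl) = m≤m+n _ _
∑-∈ f (there i) = ≤-trans (∑-∈ f i) (m≤n+m _ _)

-- Enumeration of subsets and vertices

subsets : ∀ n → List (Subset n)
subsets zero = [] ∷ []
subsets (suc n) = map (outside ∷_) (subsets n) ++ map (inside ∷_) (subsets n)

∈-subsets : (H : Subset n) → H ∈ˡ subsets n
∈-subsets [] = here refl
∈-subsets (outside ∷ H) = ∈-++⁺ˡ (∈-map⁺ _ (∈-subsets H))
∈-subsets (inside ∷ H) = ∈-++⁺ʳ _ (∈-map⁺ _ (∈-subsets H))

vertices : ∀ n → List (Fin n)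
vertices zero = []
vertices (suc n) = zero ∷ map suc (vertices n)

∈-vertices : (v : Fin n) → v ∈ˡ vertices n
∈-vertices zero = here refl
∈-vertices (suc v) = there (∈-map⁺ suc (∈-vertices v))

∑ₛ : ∀ {n} → (Subset n → ℕ) → ℕ
∑ₛ {n} = ∑ (subsets n)

∑ᵥ : ∀ {n} → (Fin n → ℕ) → ℕ
∑ᵥ {n} = ∑ (vertices n)

∑ₛ-∷ : (f : Subset (suc n) → ℕ) → ∑ₛ f ≡ ∑ₛ (f ∘ (outside ∷_)) + ∑ₛ (f ∘ (inside ∷_))
∑ₛ-∷ {n} f = begin
  ∑ (map (outside ∷_) (subsets n) ++ map (inside ∷_) (subsets n)) f
    ≡⟨ ∑-++ (map (outside ∷_) (subsets n)) _ f ⟩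
  ∑ (map (outside ∷_) (subsets n)) f + ∑ (map (inside ∷_) (subsets n)) f
    ≡⟨ cong₂ _+_ (∑-map (outside ∷_) (subsets n) f) (∑-map (inside ∷_) (subsets n) f) ⟩
  _ ∎
  where open ≡-Reasoning

∑ᵥ-∷ : (f : Fin (suc n) → ℕ) → ∑ᵥ f ≡ f zero + ∑ᵥ (f ∘ suc)
∑ᵥ-∷ {n} f = cong (f zero +_) (∑-map suc (vertices n) f)

∣p∣≡∑ : (H : Subset n) → ∣ H ∣ ≡ ∑ᵥ (λ v → (v ∈? H) ▸ 1)
∣p∣≡∑ [] = refl
∣p∣≡∑ (outside ∷ H) = trans (∣p∣≡∑ H) (sym (∑ᵥ-∷ (λ v → (v ∈? (outside ∷ H)) ▸ 1)))
∣p∣≡∑ (inside ∷ H) = trans (cong suc (∣p∣≡∑ H)) (sym (∑ᵥ-∷ (λ v → (v ∈? (inside ∷ H)) ▸ 1)))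

∑-const : (n c : ℕ) → ∑ᵥ {n} (λ _ → c) ≡ n * c
∑-const zero c = refl
∑-const (suc n) c = trans (∑ᵥ-∷ {n} (λ _ → c)) (cong (c +_) (∑-const n c))

∑-diff : (H D : Subset n) → H ⊆ D →
  ∑ᵥ (λ v → (v ∈? D ×-dec ¬? (v ∈? H)) ▸ 1) ≡ ∣ D ∣ ∸ ∣ H ∣
∑-diff H D H⊆D = sym (m+n≡o⇒n≡o∸m (begin
  ∣ H ∣ + ∑ᵥ (λ v → (v ∈? D ×-dec ¬? (v ∈? H)) ▸ 1)
    ≡⟨ cong₂ _+_ (∣p∣≡∑ H) refl ⟩
  ∑ᵥ (λ v → (v ∈? H) ▸ 1) + ∑ᵥ (λ v → (v ∈? D ×-dec ¬? (v ∈? H)) ▸ 1)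
    ≡⟨ ∑-+ (vertices _) (λ v → (v ∈? H) ▸ 1) (λ v → (v ∈? D ×-dec ¬? (v ∈? H)) ▸ 1) ⟨
  ∑ᵥ (λ v → ((v ∈? H) ▸ 1) + ((v ∈? D ×-dec ¬? (v ∈? H)) ▸ 1))
    ≡⟨ ∑-cong (vertices _) (λ v → trans (cong₂ _+_
         (▸-cong (v ∈? H) (v ∈? D ×-dec v ∈? H) (λ h → H⊆D h , h) proj₂ (λ _ → refl)) refl)
         (sym (▸-split (v ∈? D) (v ∈? H)))) ⟩
  ∑ᵥ (λ v → (v ∈? D) ▸ 1)
    ≡⟨ ∣p∣≡∑ D ⟨
  ∣ D ∣ ∎))
  where
  open ≡-Reasoning
  m+n≡o⇒n≡o∸m : ∀ {m k o} → m + k ≡ o → o ∸ m ≡ k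
  m+n≡o⇒n≡o∸m {m} {k} refl = m+n∸m≡n m k

-- Binomial sums and intervals of the Boolean lattice

-- This is the sum of `C(m, j) * h j` over `j`, that is, of `h` over the sizes of all subsets of an
-- `m`-set; the recursion is Pascal's rule.
cube : ℕ → (ℕ → ℕ) → ℕ
cube zero h = h 0
cube (suc m) h = cube m h + cube m (h ∘ suc)

cube-cong : ∀ m {g h : ℕ → ℕ} → (∀ j → g j ≡ h j) → cube m g ≡ cube m h
cube-cong zero eq = eq 0
cube-cong (suc m) eq = cong₂ _+_ (cube-cong m eq) (cube-cong m (eq ∘ suc))

cube-+ : ∀ m (g h : ℕ → ℕ) → cube m (λ j → g j + h j) ≡ cube m g + cube m h
cube-+ zero g h = refl
cube-+ (suc m) g h rewrite cube-+ m g h | cube-+ m (g ∘ suc) (h ∘ suc) =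
  lemma (cube m g) (cube m h) (cube m (g ∘ suc)) (cube m (h ∘ suc))
  where
  lemma : ∀ a b c d → a + b + (c + d) ≡ a + c + (b + d)
  lemma = solve-∀

cube-*ˡ : ∀ m c (h : ℕ → ℕ) → cube m (λ j → c * h j) ≡ c * cube m h
cube-*ˡ zero c h = refl
cube-*ˡ (suc m) c h rewrite cube-*ˡ m c h | cube-*ˡ m c (h ∘ suc) =
  sym (*-distribˡ-+ c (cube m h) (cube m (h ∘ suc)))

cube-1 : ∀ m c → cube m (λ _ → c) ≡ 2 ^ m * c
cube-1 zero c = sym (+-identityʳ c)
cube-1 (suc m) c rewrite cube-1 m c = lemma (2 ^ m) c
  where
  lemma : ∀ a c → a * c + a * c ≡ 2 * a * c
  lemma = solve-∀

-- The absorption identity `j * C(m + 1, j) = (m + 1) * C(m, j - 1)`, a double count of pairs of a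
-- subset and one of its elements.
cube-size : ∀ m (h : ℕ → ℕ) → cube (suc m) (λ j → j * h j) ≡ suc m * cube m (h ∘ suc)
cube-size zero h = refl
cube-size (suc m) h = begin
  cube (suc m) (λ j → j * h j) + cube (suc m) (λ j → h (suc j) + j * h (suc j))
    ≡⟨ cong₂ _+_ (cube-size m h) (trans (cube-+ (suc m) (h ∘ suc) (λ j → j * h (suc j)))
         (cong (cube (suc m) (h ∘ suc) +_) (cube-size m (h ∘ suc)))) ⟩
  suc m * cube m (h ∘ suc) + (cube (suc m) (h ∘ suc) + suc m * cube m (λ j → h (2 + j)))
    ≡⟨ lemma (suc m) (cube m (h ∘ suc)) (cube m (λ j → h (2 + j))) ⟩
  suc (suc m) * cube (suc m) (h ∘ suc) ∎
  where
  open ≡-Reasoning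
  lemma : ∀ m a b → m * a + (a + b + m * b) ≡ (1 + m) * (a + b)
  lemma = solve-∀

∑ₛ-interval : (P D : Subset n) (m : ℕ) (h : ℕ → ℕ) → P ⊆ D → ∣ D ∣ ≡ m + ∣ P ∣ →
  ∑ₛ (λ X → (P ⊆? X ×-dec X ⊆? D) ▸ h ∣ X ∣) ≡ cube m (λ j → h (j + ∣ P ∣))
∑ₛ-interval [] [] zero h P⊆D eq = +-identityʳ _
∑ₛ-interval {suc n} (inside ∷ P) (outside ∷ D) m h P⊆D eq with () ← P⊆D here
∑ₛ-interval {suc n} (inside ∷ P) (inside ∷ D) m h P⊆D eq = begin
  ∑ₛ (λ X → ((inside ∷ P) ⊆? X ×-dec X ⊆? (inside ∷ D)) ▸ h ∣ X ∣)
    ≡⟨ ∑ₛ-∷ (λ X → ((inside ∷ P) ⊆? X ×-dec X ⊆? (inside ∷ D)) ▸ h ∣ X ∣) ⟩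
  ∑ₛ {n} (λ _ → 0) + ∑ₛ (λ X → (P ⊆? X ×-dec X ⊆? D) ▸ h (suc ∣ X ∣))
    ≡⟨ cong₂ _+_ (∑-zero (subsets n)) (∑ₛ-interval P D m (h ∘ suc) (drop-∷-⊆ P⊆D)
         (suc-injective (trans eq (+-suc m _)))) ⟩
  cube m (λ j → h (suc (j + ∣ P ∣)))
    ≡⟨ cube-cong m (λ j → cong h (sym (+-suc j _))) ⟩
  cube m (λ j → h (j + suc ∣ P ∣)) ∎
  where open ≡-Reasoning
∑ₛ-interval {suc n} (outside ∷ P) (outside ∷ D) m h P⊆D eq = begin
  ∑ₛ (λ X → ((outside ∷ P) ⊆? X ×-dec X ⊆? (outside ∷ D)) ▸ h ∣ X ∣)
    ≡⟨ ∑ₛ-∷ (λ X → ((outside ∷ P) ⊆? X ×-dec X ⊆? (outside ∷ D)) ▸ h ∣ X ∣) ⟩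
  ∑ₛ (λ X → (P ⊆? X ×-dec X ⊆? D) ▸ h ∣ X ∣) + ∑ₛ (λ X → if does (P ⊆? X) ∧ false then h (suc ∣ X ∣) else 0)
    ≡⟨ cong₂ _+_ (∑ₛ-interval P D m h (drop-∷-⊆ P⊆D) eq)
         (trans (∑-cong (subsets n) (λ X → lem (does (P ⊆? X)))) (∑-zero (subsets n))) ⟩
  cube m (λ j → h (j + ∣ P ∣)) + 0
    ≡⟨ +-identityʳ _ ⟩
  cube m (λ j → h (j + ∣ P ∣)) ∎
  where
  open ≡-Reasoning
  lem : ∀ b {x : ℕ} → (if b ∧ false then x else 0) ≡ 0
  lem true = refl
  lem false = refl
∑ₛ-interval {suc n} (outside ∷ P) (inside ∷ D) zero h P⊆D eq =
  contradiction (≤-trans (≤-reflexive eq) (p⊆q⇒∣p∣≤∣q∣ (drop-∷-⊆ P⊆D))) 1+n≰n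
∑ₛ-interval {suc n} (outside ∷ P) (inside ∷ D) (suc m) h P⊆D eq = begin
  ∑ₛ (λ X → ((outside ∷ P) ⊆? X ×-dec X ⊆? (inside ∷ D)) ▸ h ∣ X ∣)
    ≡⟨ ∑ₛ-∷ (λ X → ((outside ∷ P) ⊆? X ×-dec X ⊆? (inside ∷ D)) ▸ h ∣ X ∣) ⟩
  ∑ₛ (λ X → (P ⊆? X ×-dec X ⊆? D) ▸ h ∣ X ∣) + ∑ₛ (λ X → (P ⊆? X ×-dec X ⊆? D) ▸ h (suc ∣ X ∣))
    ≡⟨ cong₂ _+_ (∑ₛ-interval P D m h (drop-∷-⊆ P⊆D) (suc-injective eq))
         (∑ₛ-interval P D m (h ∘ suc) (drop-∷-⊆ P⊆D) (suc-injective eq)) ⟩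
  cube (suc m) (λ j → h (j + ∣ P ∣)) ∎
  where open ≡-Reasoning

-- Katona's bound for antitone rank weights of down-closed families

Family : ℕ → Set
Family n = Subset n → Bool

count : Family n → ℕ
count F = ∑ₛ (λ H → T? (F H) ▸ 1)

DownClosed : Family n → Set
DownClosed F = ∀ {A B} → A ⊆ B → T (F B) → T (F A)

Antitone : (ℕ → ℕ) → Set
Antitone g = ∀ {i j} → i ≤ j → g j ≤ g i

-- initial n g m is the sum of g (popcount i) over i < m, for m ≤ 2 ^ n: the even and the odd i
-- contribute the two summands.
initial : ℕ → (ℕ → ℕ) → ℕ → ℕ
initial zero g m = m * g 0
initial (suc n) g m = initial n g ⌈ m /2⌉ + initial n (g ∘ suc) ⌊ m /2⌋

halve : ∀ m → ∃ λ i → m ≡ i + i ⊎ m ≡ suc (i + i)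
halve zero = 0 , inj₁ refl
halve (suc m) with halve m
... | i , inj₁ eq = i , inj₂ (cong suc eq)
... | i , inj₂ eq = suc i , inj₁ (cong suc (trans eq (sym (+-suc i i))))

parity : ℕ → ℕ
parity zero = 0
parity (suc zero) = 1
parity (suc (suc m)) = parity m

parity-even : ∀ i → parity (i + i) ≡ 0
parity-even zero = refl
parity-even (suc i) = trans (cong parity (cong suc (+-suc i i))) (parity-even i)

parity-odd : ∀ i → parity (suc (i + i)) ≡ 1
parity-odd zero = refl
parity-odd (suc i) = trans (cong parity (cong (2 +_) (+-suc i i))) (parity-odd i)

popcount : ℕ → ℕ → ℕ
popcount zero m = 0
popcount (suc n) m = parity m + popcount n ⌊ m /2⌋

popcount-even : ∀ n i → popcount (suc n) (i + i) ≡ popcount n i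
popcount-even n i = cong₂ _+_ (parity-even i) (cong (popcount n) (sym (n≡⌊n+n/2⌋ i)))

popcount-odd : ∀ n i → popcount (suc n) (suc (i + i)) ≡ suc (popcount n i)
popcount-odd n i = cong₂ _+_ (parity-odd i) (cong (popcount n) (sym (n≡⌈n+n/2⌉ i)))

-- Adding 1 clears the trailing ones and sets at most one new bit.
popcount-suc : ∀ n m → popcount n (suc m) ≤ suc (popcount n m)
popcount-suc zero m = z≤n
popcount-suc (suc n) m with halve m
... | i , inj₁ refl = ≤-reflexive (trans (popcount-odd n i) (cong suc (sym (popcount-even n i))))
... | i , inj₂ refl = begin
  popcount (suc n) (2 + (i + i))     ≡⟨ cong (popcount (suc n)) (cong suc (+-suc i i)) ⟨
  popcount (suc n) (suc i + suc i)   ≡⟨ popcount-even n (suc i) ⟩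
  popcount n (suc i)                 ≤⟨ popcount-suc n i ⟩
  suc (popcount n i)                 ≤⟨ n≤1+n _ ⟩
  2 + popcount n i                   ≡⟨ cong suc (popcount-odd n i) ⟨
  suc (popcount (suc n) (suc (i + i))) ∎
  where open ≤-Reasoning

popcount-+ : ∀ n m j → popcount n (m + j) ≤ popcount n m + j
popcount-+ n m zero = ≤-reflexive (trans (cong (popcount n) (+-identityʳ m)) (sym (+-identityʳ _)))
popcount-+ n m (suc j) = begin
  popcount n (m + suc j)     ≡⟨ cong (popcount n) (+-suc m j) ⟩
  popcount n (suc (m + j))   ≤⟨ popcount-suc n (m + j) ⟩
  suc (popcount n (m + j))   ≤⟨ s≤s (popcount-+ n m j) ⟩
  suc (popcount n m + j)     ≡⟨ +-suc _ j ⟨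
  popcount n m + suc j       ∎
  where open ≤-Reasoning

popcount-ones : ∀ n k m → k ≤ n → suc m ≡ 2 ^ k → popcount n m ≡ k
popcount-ones n zero zero k≤n eq = zeros n
  where
  zeros : ∀ n → popcount n 0 ≡ 0
  zeros zero = refl
  zeros (suc n) = zeros n
popcount-ones (suc n) (suc k) m (s≤s k≤n) eq with halve m
... | i , inj₁ refl = contradiction (trans (sym (parity-odd i))
        (trans (cong parity (trans eq (cong (2 ^ k +_) (+-identityʳ (2 ^ k))))) (parity-even (2 ^ k))))
        λ ()
... | i , inj₂ refl = trans (popcount-odd n i) (cong suc (popcount-ones n k i k≤n
        (trans (n≡⌊n+n/2⌋ (suc i)) (trans (cong ⌊_/2⌋ double) (sym (n≡⌊n+n/2⌋ (2 ^ k)))))))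
  where
  double : suc i + suc i ≡ 2 ^ k + 2 ^ k
  double = trans (cong suc (+-suc i i)) (trans eq (cong (2 ^ k +_) (+-identityʳ (2 ^ k))))

initial-suc : ∀ n g m → initial n g (suc m) ≡ initial n g m + g (popcount n m)
initial-suc zero g m = +-comm (g 0) (m * g 0)
initial-suc (suc n) g m with halve m
... | i , inj₁ refl rewrite popcount-even n i | sym (n≡⌊n+n/2⌋ i) | sym (n≡⌈n+n/2⌉ i) | initial-suc n g i =
  lemma (initial n g i) (g (popcount n i)) (initial n (g ∘ suc) i)
  where
  lemma : ∀ a b c → a + b + c ≡ a + c + b
  lemma = solve-∀
... | i , inj₂ refl rewrite popcount-odd n i | sym (n≡⌊n+n/2⌋ i) | sym (n≡⌈n+n/2⌉ i) | initial-suc n (g ∘ suc) i =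
  sym (+-assoc (initial n g (suc i)) _ _)

initial-mono : ∀ n g {m m′} → m ≤ m′ → initial n g m ≤ initial n g m′
initial-mono n g {m} m≤m′ = go (≤⇒≤′ m≤m′)
  where
  go : ∀ {m′} → m ≤′ m′ → initial n g m ≤ initial n g m′
  go ≤′-refl = ≤-refl
  go (≤′-step le) = ≤-trans (go le) (≤-trans (m≤m+n _ _) (≤-reflexive (sym (initial-suc n g _))))

initial-zero : ∀ n g → initial n g 0 ≡ 0
initial-zero zero g = refl
initial-zero (suc n) g = cong₂ _+_ (initial-zero n g) (initial-zero n (g ∘ suc))

initial-cube : ∀ n k g → k ≤ n → initial n g (2 ^ k) ≡ cube k g
initial-cube zero zero g k≤n = +-identityʳ (g 0)
initial-cube (suc n) zero g k≤n =
  trans (cong₂ _+_ (initial-cube n zero g z≤n) (initial-zero n (g ∘ suc))) (+-identityʳ (g 0))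
initial-cube (suc n) (suc k) g (s≤s k≤n) rewrite +-identityʳ (2 ^ k) | sym (n≡⌊n+n/2⌋ (2 ^ k)) | sym (n≡⌈n+n/2⌉ (2 ^ k)) =
  cong₂ _+_ (initial-cube n k g k≤n) (initial-cube n k (g ∘ suc) k≤n)

module _ {g : ℕ → ℕ} (anti : Antitone g) where

  -- The number `2 ^ k - 1` has `k` ones and each step down loses at most one of them, so the last
  -- `e` integers below `2 ^ k` have at least `k - e` ones and contribute at most `g (k ∸ e)` each.
  cube≤initial : ∀ n k → k ≤ n → ∀ m e → m + e ≡ 2 ^ k → cube k g ≤ initial n g m + e * g (k ∸ e)
  cube≤initial n k k≤n m e eq = subst (λ x → x ≤ initial n g m + e * g (k ∸ e))
    (trans (cong (initial n g) eq) (initial-cube n k g k≤n)) (go e e ≤-refl m eq)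
    where
    open ≤-Reasoning
    go : ∀ e e′ → e ≤ e′ → ∀ m → m + e ≡ 2 ^ k → initial n g (m + e) ≤ initial n g m + e * g (k ∸ e′)
    go zero e′ e≤ m eq = ≤-trans (≤-reflexive (cong (initial n g) (+-identityʳ m))) (m≤m+n _ _)
    go (suc e) e′ e≤ m eq = begin
      initial n g (m + suc e)
        ≡⟨ cong (initial n g) (+-suc m e) ⟩
      initial n g (suc m + e)
        ≤⟨ go e e′ (≤-trans (n≤1+n e) e≤) (suc m) (trans (sym (+-suc m e)) eq) ⟩
      initial n g (suc m) + e * g (k ∸ e′)
        ≡⟨ cong (_+ e * g (k ∸ e′)) (initial-suc n g m) ⟩
      initial n g m + g (popcount n m) + e * g (k ∸ e′)
        ≤⟨ +-monoˡ-≤ (e * g (k ∸ e′)) (+-monoʳ-≤ (initial n g m) (anti low)) ⟩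
      initial n g m + g (k ∸ e′) + e * g (k ∸ e′)
        ≡⟨ +-assoc (initial n g m) _ _ ⟩
      initial n g m + suc e * g (k ∸ e′) ∎
      where
      low : k ∸ e′ ≤ popcount n m
      low = begin
        k ∸ e′                       ≤⟨ ∸-monoʳ-≤ k (≤-trans (n≤1+n e) e≤) ⟩
        k ∸ e                        ≡⟨ cong (_∸ e) (popcount-ones n k (m + e) k≤n (trans (sym (+-suc m e)) eq)) ⟨
        popcount n (m + e) ∸ e       ≤⟨ ∸-monoˡ-≤ e (popcount-+ n m e) ⟩
        popcount n m + e ∸ e         ≡⟨ m+n∸n≡m (popcount n m) e ⟩
        popcount n m                 ∎

antitone-suc : ∀ {g} → Antitone g → Antitone (g ∘ suc)
antitone-suc anti = anti ∘ s≤s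

interchange : ∀ a b → a + a + (b + b) ≡ a + b + (a + b)
interchange = solve-∀

middle : ∀ a b c d → a + b + (c + d) ≡ a + c + (b + d)
middle = solve-∀

-- The merging step of Katona's induction. The even and the odd members of the two segments are
-- merged separately, according to the parities of `a` and `b`; the condition `b ≤ a` survives the
-- halving in all four cases.
initial-+ : ∀ n {g} → Antitone g → ∀ a b → b ≤ a →
  initial (suc n) g (a + b) ≤ initial n g a + initial n (g ∘ suc) b
initial-+ zero {g} anti a b b≤a = begin
  h * g 0 + l * g 1                ≡⟨ cong (λ x → h * g 0 + x * g 1) l≡ ⟩
  h * g 0 + (b + t) * g 1          ≡⟨ lemma₁ h b t (g 0) (g 1) ⟩
  h * g 0 + b * g 1 + t * g 1      ≤⟨ +-monoʳ-≤ (h * g 0 + b * g 1) (*-monoʳ-≤ t (anti z≤n)) ⟩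
  h * g 0 + b * g 1 + t * g 0      ≡⟨ lemma₂ h b t (g 0) (g 1) ⟩
  (h + t) * g 0 + b * g 1          ≡⟨ cong (λ x → x * g 0 + b * g 1) a≡ ⟩
  a * g 0 + b * g 1                ∎
  where
  open ≤-Reasoning
  h = ⌈ a + b /2⌉
  l = ⌊ a + b /2⌋
  h≤a : h ≤ a
  h≤a = ≤-trans (⌈n/2⌉-mono (+-monoʳ-≤ a b≤a)) (≤-reflexive (sym (n≡⌈n+n/2⌉ a)))
  t = a ∸ h
  a≡ : h + t ≡ a
  a≡ = m+[n∸m]≡n h≤a
  l≡ : l ≡ b + t
  l≡ = +-cancelˡ-≡ h l (b + t) (trans (+-comm h l) (trans (⌊n/2⌋+⌈n/2⌉≡n (a + b))
         (trans (cong (_+ b) (sym a≡)) (lemma h t b))))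
    where
    lemma : ∀ h t b → h + t + b ≡ h + (b + t)
    lemma = solve-∀
  lemma₁ : ∀ h b t x y → h * x + (b + t) * y ≡ h * x + b * y + t * y
  lemma₁ = solve-∀
  lemma₂ : ∀ h b t x y → h * x + b * y + t * x ≡ (h + t) * x + b * y
  lemma₂ = solve-∀
initial-+ (suc n) {g} anti a b b≤a with halve a | halve b
... | p , inj₁ refl | r , inj₁ refl
  rewrite sym (n≡⌊n+n/2⌋ p) | sym (n≡⌈n+n/2⌉ p) | sym (n≡⌊n+n/2⌋ r) | sym (n≡⌈n+n/2⌉ r)
        | interchange p r | sym (n≡⌊n+n/2⌋ (p + r)) | sym (n≡⌈n+n/2⌉ (p + r)) = begin
  initial (suc n) g (p + r) + initial (suc n) (g ∘ suc) (p + r)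
    ≤⟨ +-mono-≤ (initial-+ n anti p r r≤p) (initial-+ n (antitone-suc anti) p r r≤p) ⟩
  initial n g p + initial n (g ∘ suc) r + (initial n (g ∘ suc) p + initial n (λ j → g (2 + j)) r)
    ≡⟨ middle (initial n g p) _ _ _ ⟩
  initial n g p + initial n (g ∘ suc) p + (initial n (g ∘ suc) r + initial n (λ j → g (2 + j)) r) ∎
  where
  open ≤-Reasoning
  r≤p : r ≤ p
  r≤p = ≤-trans (≤-reflexive (n≡⌊n+n/2⌋ r)) (≤-trans (⌊n/2⌋-mono b≤a) (≤-reflexive (sym (n≡⌊n+n/2⌋ p))))
... | p , inj₁ refl | r , inj₂ refl
  rewrite sym (n≡⌊n+n/2⌋ p) | sym (n≡⌈n+n/2⌉ p) | sym (n≡⌊n+n/2⌋ r) | sym (n≡⌈n+n/2⌉ r)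
        | +-suc (p + p) (r + r) | interchange p r | sym (n≡⌊n+n/2⌋ (p + r)) | sym (n≡⌈n+n/2⌉ (p + r)) = begin
  initial (suc n) g (suc (p + r)) + initial (suc n) (g ∘ suc) (p + r)
    ≡⟨ cong (λ x → initial (suc n) g x + initial (suc n) (g ∘ suc) (p + r)) (sym (+-suc p r)) ⟩
  initial (suc n) g (p + suc r) + initial (suc n) (g ∘ suc) (p + r)
    ≤⟨ +-mono-≤ (initial-+ n anti p (suc r) r<p) (initial-+ n (antitone-suc anti) p r (≤-trans (n≤1+n r) r<p)) ⟩
  initial n g p + initial n (g ∘ suc) (suc r) + (initial n (g ∘ suc) p + initial n (λ j → g (2 + j)) r)
    ≡⟨ middle (initial n g p) _ _ _ ⟩
  initial n g p + initial n (g ∘ suc) p + (initial n (g ∘ suc) (suc r) + initial n (λ j → g (2 + j)) r) ∎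
  where
  open ≤-Reasoning
  r<p : suc r ≤ p
  r<p = ≤-trans (≤-reflexive (cong suc (n≡⌊n+n/2⌋ r))) (≤-trans (⌈n/2⌉-mono b≤a) (≤-reflexive (sym (n≡⌈n+n/2⌉ p))))
... | p , inj₂ refl | r , inj₁ refl
  rewrite sym (n≡⌊n+n/2⌋ p) | sym (n≡⌈n+n/2⌉ p) | sym (n≡⌊n+n/2⌋ r) | sym (n≡⌈n+n/2⌉ r)
        | interchange p r | sym (n≡⌊n+n/2⌋ (p + r)) | sym (n≡⌈n+n/2⌉ (p + r)) = begin
  initial (suc n) g (suc p + r) + initial (suc n) (g ∘ suc) (p + r)
    ≤⟨ +-mono-≤ (initial-+ n anti (suc p) r (≤-trans r≤p (n≤1+n p))) (initial-+ n (antitone-suc anti) p r r≤p) ⟩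
  initial n g (suc p) + initial n (g ∘ suc) r + (initial n (g ∘ suc) p + initial n (λ j → g (2 + j)) r)
    ≡⟨ middle (initial n g (suc p)) _ _ _ ⟩
  initial n g (suc p) + initial n (g ∘ suc) p + (initial n (g ∘ suc) r + initial n (λ j → g (2 + j)) r) ∎
  where
  open ≤-Reasoning
  r≤p : r ≤ p
  r≤p = ≤-trans (≤-reflexive (n≡⌊n+n/2⌋ r)) (≤-trans (⌊n/2⌋-mono b≤a) (≤-reflexive (sym (n≡⌈n+n/2⌉ p))))
... | p , inj₂ refl | r , inj₂ refl
  rewrite sym (n≡⌊n+n/2⌋ p) | sym (n≡⌈n+n/2⌉ p) | sym (n≡⌊n+n/2⌋ r) | sym (n≡⌈n+n/2⌉ r)
        | +-suc (p + p) (r + r) | interchange p r | sym (n≡⌊n+n/2⌋ (p + r)) | sym (n≡⌈n+n/2⌉ (p + r)) = begin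
  initial (suc n) g (suc (p + r)) + initial (suc n) (g ∘ suc) (suc (p + r))
    ≡⟨ cong (initial (suc n) g (suc (p + r)) +_) (initial-suc (suc n) (g ∘ suc) (p + r)) ⟩
  initial (suc n) g (suc (p + r)) + (initial (suc n) (g ∘ suc) (p + r) + g (suc (popcount (suc n) (p + r))))
    -- Both halves have length `p + r + 1`, but the induction hypothesis wants `p + r + 2` and
    -- `p + r`. So the last integer `p + r` of the odd half is traded for `p + r + 1` in the even
    -- half, whose rank is not larger.
    ≤⟨ +-monoʳ-≤ (initial (suc n) g (suc (p + r))) (+-monoʳ-≤ (initial (suc n) (g ∘ suc) (p + r))
         (anti (popcount-suc (suc n) (p + r)))) ⟩
  initial (suc n) g (suc (p + r)) + (initial (suc n) (g ∘ suc) (p + r) + g (popcount (suc n) (suc (p + r))))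
    ≡⟨ right (initial (suc n) g (suc (p + r))) _ _ ⟩
  initial (suc n) g (suc (p + r)) + g (popcount (suc n) (suc (p + r))) + initial (suc n) (g ∘ suc) (p + r)
    ≡⟨ cong (_+ initial (suc n) (g ∘ suc) (p + r)) (initial-suc (suc n) g (suc (p + r))) ⟨
  initial (suc n) g (suc (suc (p + r))) + initial (suc n) (g ∘ suc) (p + r)
    ≡⟨ cong (λ x → initial (suc n) g x + initial (suc n) (g ∘ suc) (p + r)) (cong suc (sym (+-suc p r))) ⟩
  initial (suc n) g (suc p + suc r) + initial (suc n) (g ∘ suc) (p + r)
    ≤⟨ +-mono-≤ (initial-+ n anti (suc p) (suc r) (s≤s r≤p)) (initial-+ n (antitone-suc anti) p r r≤p) ⟩
  initial n g (suc p) + initial n (g ∘ suc) (suc r) + (initial n (g ∘ suc) p + initial n (λ j → g (2 + j)) r)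
    ≡⟨ middle (initial n g (suc p)) _ _ _ ⟩
  initial n g (suc p) + initial n (g ∘ suc) p + (initial n (g ∘ suc) (suc r) + initial n (λ j → g (2 + j)) r) ∎
  where
  open ≤-Reasoning
  r≤p : r ≤ p
  r≤p = ≤-trans (≤-reflexive (n≡⌈n+n/2⌉ r)) (≤-trans (⌊n/2⌋-mono b≤a) (≤-reflexive (sym (n≡⌈n+n/2⌉ p))))
  right : ∀ a b c → a + (b + c) ≡ a + c + b
  right = solve-∀

-- Induction over the ground set: the slice of sets with the first element sees the weight
-- `g ∘ suc`. Down-closedness passes to both slices and puts one inside the other, which is the
-- inequality of counts that `initial-+` asks for.
katona : ∀ n {g} → Antitone g → (X : Family n) → DownClosed X →
  initial n g (count X) ≤ ∑ₛ (λ A → T? (X A) ▸ g ∣ A ∣)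
katona zero {g} anti X down with X []
... | true = ≤-reflexive refl
... | false = z≤n
katona (suc n) {g} anti X down = begin
  initial (suc n) g (count X)
    ≡⟨ cong (initial (suc n) g) (∑ₛ-∷ (λ H → T? (X H) ▸ 1)) ⟩
  initial (suc n) g (count X₀ + count X₁)
    ≤⟨ initial-+ n anti (count X₀) (count X₁)
         (∑-mono (subsets n) λ A → ▸-mono (T? (X₁ A)) (T? (X₀ A)) (down (out⊆ ⊆-refl)) λ _ → ≤-refl) ⟩
  initial n g (count X₀) + initial n (g ∘ suc) (count X₁)
    ≤⟨ +-mono-≤ (katona n anti X₀ (down ∘ s⊆s)) (katona n (antitone-suc anti) X₁ (down ∘ s⊆s)) ⟩
  ∑ₛ (λ A → T? (X₀ A) ▸ g ∣ A ∣) + ∑ₛ (λ A → T? (X₁ A) ▸ g (suc ∣ A ∣))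
    ≡⟨ ∑ₛ-∷ (λ A → T? (X A) ▸ g ∣ A ∣) ⟨
  ∑ₛ (λ A → T? (X A) ▸ g ∣ A ∣) ∎
  where
  open ≤-Reasoning
  X₀ X₁ : Family n
  X₀ = X ∘ (outside ∷_)
  X₁ = X ∘ (inside ∷_)

-- Stars, links and counting by witnesses

⁅⁆⊆ : {v : Fin n} {H : Subset n} → v ∈ H → ⁅ v ⁆ ⊆ H
⁅⁆⊆ {v = v} {H} v∈H x∈ = subst (_∈ H) (sym (x∈⁅y⁆⇒x≡y v x∈)) v∈H

∪-least : {H K D : Subset n} → H ⊆ D → K ⊆ D → H ∪ K ⊆ D
∪-least {H = H} {K} H⊆D K⊆D x∈ with x∈p∪q⁻ H K x∈
... | inj₁ x∈H = H⊆D x∈H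
... | inj₂ x∈K = K⊆D x∈K

star : (v : Fin n) (D : Subset n) (m : ℕ) (h : ℕ → ℕ) → v ∈ D → ∣ D ∣ ≡ suc m →
  ∑ₛ (λ X → (v ∈? X ×-dec X ⊆? D) ▸ h ∣ X ∣) ≡ cube m (h ∘ suc)
star {n} v D m h v∈D eq = begin
  ∑ₛ (λ X → (v ∈? X ×-dec X ⊆? D) ▸ h ∣ X ∣)
    ≡⟨ ∑-cong (subsets n) (λ X → ▸-cong (v ∈? X ×-dec X ⊆? D) (⁅ v ⁆ ⊆? X ×-dec X ⊆? D)
         (λ (v∈X , X⊆D) → ⁅⁆⊆ v∈X , X⊆D) (λ (v⊆X , X⊆D) → v⊆X (x∈⁅x⁆ v) , X⊆D) (λ _ → refl)) ⟩
  ∑ₛ (λ X → (⁅ v ⁆ ⊆? X ×-dec X ⊆? D) ▸ h ∣ X ∣)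
    ≡⟨ ∑ₛ-interval ⁅ v ⁆ D m h (⁅⁆⊆ v∈D)
         (trans eq (trans (+-comm 1 m) (cong (m +_) (sym (∣⁅x⁆∣≡1 v))))) ⟩
  cube m (λ j → h (j + ∣ ⁅ v ⁆ ∣))
    ≡⟨ cube-cong m (λ j → cong h (trans (cong (j +_) (∣⁅x⁆∣≡1 v)) (+-comm j 1))) ⟩
  cube m (h ∘ suc) ∎
  where
  open ≡-Reasoning

∑-link : (v : Fin n) (f : Subset n → ℕ) →
  ∑ₛ (λ H → (v ∈? H) ▸ f H) ≡ ∑ₛ (λ H → ¬? (v ∈? H) ▸ f (H ∪ ⁅ v ⁆))
∑-link {suc n} zero f = begin
  ∑ₛ (λ H → (zero ∈? H) ▸ f H)
    ≡⟨ ∑ₛ-∷ (λ H → (zero ∈? H) ▸ f H) ⟩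
  ∑ₛ {n} (λ _ → 0) + ∑ₛ (λ H → f (inside ∷ H))
    ≡⟨ +-comm (∑ₛ {n} (λ _ → 0)) _ ⟩
  ∑ₛ (λ H → f (inside ∷ H)) + ∑ₛ {n} (λ _ → 0)
    ≡⟨ cong₂ _+_ (∑-cong (subsets n) (λ H → cong (f ∘ (inside ∷_)) (sym (∪-identityʳ H)))) refl ⟩
  ∑ₛ (λ H → f (inside ∷ (H ∪ ⊥))) + ∑ₛ {n} (λ _ → 0)
    ≡⟨ ∑ₛ-∷ (λ H → ¬? (zero ∈? H) ▸ f (H ∪ ⁅ zero ⁆)) ⟨
  ∑ₛ (λ H → ¬? (zero ∈? H) ▸ f (H ∪ ⁅ zero ⁆)) ∎
  where open ≡-Reasoning
∑-link {suc n} (suc v) f = begin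
  ∑ₛ (λ H → (suc v ∈? H) ▸ f H)
    ≡⟨ ∑ₛ-∷ (λ H → (suc v ∈? H) ▸ f H) ⟩
  ∑ₛ (λ H → (v ∈? H) ▸ f (outside ∷ H)) + ∑ₛ (λ H → (v ∈? H) ▸ f (inside ∷ H))
    ≡⟨ cong₂ _+_ (∑-link v (f ∘ (outside ∷_))) (∑-link v (f ∘ (inside ∷_))) ⟩
  ∑ₛ (λ H → ¬? (v ∈? H) ▸ f (outside ∷ (H ∪ ⁅ v ⁆))) + ∑ₛ (λ H → ¬? (v ∈? H) ▸ f (inside ∷ (H ∪ ⁅ v ⁆)))
    ≡⟨ ∑ₛ-∷ (λ H → ¬? (suc v ∈? H) ▸ f (H ∪ ⁅ suc v ⁆)) ⟨
  ∑ₛ (λ H → ¬? (suc v ∈? H) ▸ f (H ∪ ⁅ suc v ⁆)) ∎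
  where open ≡-Reasoning

∣p∪⁅v⁆∣ : (v : Fin n) (H : Subset n) → v ∉ H → ∣ H ∪ ⁅ v ⁆ ∣ ≡ suc ∣ H ∣
∣p∪⁅v⁆∣ zero (outside ∷ H) v∉H = cong suc (cong ∣_∣ (∪-identityʳ H))
∣p∪⁅v⁆∣ zero (inside ∷ H) v∉H = contradiction here v∉H
∣p∪⁅v⁆∣ (suc v) (outside ∷ H) v∉H = ∣p∪⁅v⁆∣ v H (v∉H ∘ there)
∣p∪⁅v⁆∣ (suc v) (inside ∷ H) v∉H = cong suc (∣p∪⁅v⁆∣ v H (v∉H ∘ there))

∣p∪⁅v⁆∣≤ : (v : Fin n) (H : Subset n) → ∣ H ∪ ⁅ v ⁆ ∣ ≤ suc ∣ H ∣
∣p∪⁅v⁆∣≤ v H with v ∈? H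
... | no v∉H = ≤-reflexive (∣p∪⁅v⁆∣ v H v∉H)
... | yes v∈H = ≤-trans (p⊆q⇒∣p∣≤∣q∣ (λ i → ∪-least ⊆-refl (⁅⁆⊆ v∈H) i)) (n≤1+n _)

⊆∧∣≥∣⇒≡ : {H D : Subset n} → H ⊆ D → ∣ D ∣ ≤ ∣ H ∣ → H ≡ D
⊆∧∣≥∣⇒≡ {H = H} {D} H⊆D D≤H = ⊆-antisym H⊆D D⊆H
  where
  D⊆H : D ⊆ H
  D⊆H {x} x∈D with x ∈? H
  ... | yes x∈H = x∈H
  ... | no x∉H = contradiction (p⊂q⇒∣p∣<∣q∣ (H⊆D , x , x∈D , x∉H)) (≤⇒≯ D≤H)

∑-const-▸ : (l : List A) {P : A → Set} (P? : ∀ x → Dec (P x)) (c : ℕ) →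
  ∑ l (λ x → P? x ▸ c) ≡ c * ∑ l (λ x → P? x ▸ 1)
∑-const-▸ l P? c = trans
  (∑-cong l (λ x → trans (cong (P? x ▸_) (sym (*-identityʳ c))) (sym (▸-*ˡ (P? x) c))))
  (∑-*ˡ l c (λ x → P? x ▸ 1))

-- A union bound: every `u` is charged to some set `H` that accounts for it. The choice need not be
-- injective, as `H` is weighted by the number of vertices it accounts for.
∑-witness : {R : Fin n → Set} {P : Subset n → Set} {S : Subset n → Fin n → Set}
  (R? : ∀ u → Dec (R u)) (P? : ∀ H → Dec (P H)) (S? : ∀ H u → Dec (S H u)) (x : ℕ) →
  (∀ u → R u → ∃ λ H → P H × S H u) →
  ∑ᵥ (λ u → R? u ▸ x) ≤ ∑ₛ (λ H → P? H ▸ ∑ᵥ (λ u → S? H u ▸ x))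
∑-witness {n} R? P? S? x wit = begin
  ∑ᵥ (λ u → R? u ▸ x)
    ≤⟨ ∑-mono (vertices n) (λ u → ▸-≤ (R? u) λ r → let H , p , s = wit u r in
         ≤-trans (≤-reflexive (sym (trans (▸-yes (P? H) p) (▸-yes (S? H u) s))))
           (∑-∈ (λ H → P? H ▸ S? H u ▸ x) (∈-subsets H))) ⟩
  ∑ᵥ (λ u → ∑ₛ (λ H → P? H ▸ S? H u ▸ x))
    ≡⟨ ∑-swap (vertices n) (subsets n) (λ u H → P? H ▸ S? H u ▸ x) ⟩
  ∑ₛ (λ H → ∑ᵥ (λ u → P? H ▸ S? H u ▸ x))
    ≡⟨ ∑-cong (subsets n) (λ H → ∑-▸ (vertices n) (P? H) (λ u → S? H u ▸ x)) ⟩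
  ∑ₛ (λ H → P? H ▸ ∑ᵥ (λ u → S? H u ▸ x)) ∎
  where open ≤-Reasoning

n<2^n : ∀ m → m < 2 ^ m
n<2^n zero = s≤s z≤n
n<2^n (suc m) = begin-strict
  suc m               <⟨ s≤s (n<2^n m) ⟩
  1 + 2 ^ m           ≤⟨ +-monoˡ-≤ (2 ^ m) (m^n>0 2 m) ⟩
  2 ^ m + 2 ^ m       ≡⟨ cong (2 ^ m +_) (+-identityʳ (2 ^ m)) ⟨
  2 ^ suc m           ∎
  where open ≤-Reasoning

cube-cong≤ : ∀ m {g h : ℕ → ℕ} → (∀ j → j ≤ m → g j ≡ h j) → cube m g ≡ cube m h
cube-cong≤ zero eq = eq 0 z≤n
cube-cong≤ (suc m) eq = cong₂ _+_ (cube-cong≤ m (λ j j≤m → eq j (m≤n⇒m≤1+n j≤m)))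
  (cube-cong≤ m (λ j j≤m → eq (suc j) (s≤s j≤m)))

cube-head : ∀ m {g h : ℕ → ℕ} c → g 0 + c ≡ h 0 → (∀ j → suc j ≤ m → g (suc j) ≡ h (suc j)) →
  cube m g + c ≡ cube m h
cube-head zero c eq₀ eq = eq₀
cube-head (suc m) {g} {h} c eq₀ eq = begin
  cube m g + cube m (g ∘ suc) + c     ≡⟨ lemma (cube m g) (cube m (g ∘ suc)) c ⟩
  cube m g + c + cube m (g ∘ suc)     ≡⟨ cong₂ _+_ (cube-head m c eq₀ (λ j j<m → eq j (m≤n⇒m≤1+n j<m)))
                                           (cube-cong≤ m (λ j j≤m → eq j (s≤s j≤m))) ⟩
  cube m h + cube m (h ∘ suc) ∎
  where
  open ≡-Reasoning
  lemma : ∀ a b c → a + b + c ≡ a + c + b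
  lemma = solve-∀

indicator₁ : ℕ → ℕ
indicator₁ 1 = 1
indicator₁ _ = 0

cube-indicator₁ : ∀ m → cube m indicator₁ ≡ m
cube-indicator₁ zero = refl
cube-indicator₁ (suc m) = trans (cong₂ _+_ (cube-indicator₁ m) (delta m)) (+-comm m 1)
  where
  zeros : ∀ m → cube m (λ _ → 0) ≡ 0
  zeros zero = refl
  zeros (suc m) = cong₂ _+_ (zeros m) (zeros m)
  delta : ∀ m → cube m (indicator₁ ∘ suc) ≡ 1
  delta zero = refl
  delta (suc m) = cong₂ _+_ (delta m) (zeros m)

-- Reciprocals of set sizes, scaled by a factorial

module Reciprocal (d : ℕ) where

  κ : ℕ
  κ = d !

  -- The factorial makes the division exact for all sizes from 1 to `d`. The value at 0 stands for
  -- no reciprocal; it is chosen so that `q` is antitone from 0 on.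
  q : ℕ → ℕ
  q zero = κ
  q (suc s) = κ / suc s

  q-exact : ∀ s → 1 ≤ s → s ≤ d → s * q s ≡ κ
  q-exact (suc s) _ s≤d = m*[n/m]≡n (∣-trans (m∣m*n (s !)) (m≤n⇒m!∣n! s≤d))

  q-antitone : Antitone q
  q-antitone {zero} {zero} _ = ≤-refl
  q-antitone {zero} {suc j} _ = m/n≤m κ (suc j)
  q-antitone {suc i} {suc j} i≤j = /-monoʳ-≤ κ i≤j

  -- What a set of size `s` is worth to each member beyond `κ`. For `1 ≤ s ≤ d` one has
  -- `s * excess s = (d - s) * κ`: the excess of all members equals `κ` for every non-member among
  -- `d` vertices.
  excess : ℕ → ℕ
  excess s = (d ∸ s) * q s

  q-split : ∀ s → 1 ≤ s → s ≤ d → d * q s ≡ κ + excess s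
  q-split s 1≤s s≤d = begin
    d * q s                     ≡⟨ cong (_* q s) (m+[n∸m]≡n s≤d) ⟨
    (s + (d ∸ s)) * q s         ≡⟨ *-distribʳ-+ (q s) s (d ∸ s) ⟩
    s * q s + (d ∸ s) * q s     ≡⟨ cong (_+ excess s) (q-exact s 1≤s s≤d) ⟩
    κ + excess s                ∎
    where open ≡-Reasoning

-- Every nonempty subset of a `(k + 1)`-set hands out `κ` in total, and by symmetry each element
-- gets the same amount; the added `κ` stands for the empty set.
cube-q : ∀ k → let open Reciprocal (suc k) in
  suc k * cube k (q ∘ suc) + κ ≡ 2 ^ suc k * κ
cube-q k = begin
  suc k * cube k (q ∘ suc) + κ                ≡⟨ cong (_+ κ) (cube-size k q) ⟨
  cube (suc k) (λ j → j * q j) + κ            ≡⟨ cube-head (suc k) κ refl (λ j j≤k → q-exact (suc j) (s≤s z≤n) j≤k) ⟩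
  cube (suc k) (λ _ → κ)                      ≡⟨ cube-1 (suc k) κ ⟩
  2 ^ suc k * κ                               ∎
  where
  open ≡-Reasoning
  open Reciprocal (suc k)

-- Degrees and discharging in a down-closed family

T-does : (p : Dec P) → T (does p) → P
T-does (yes p) _ = p

does-T : (p : Dec P) → P → T (does p)
does-T (yes _) _ = tt
does-T (no ¬p) p = contradiction p ¬p

degree : Family n → Fin n → ℕ
degree G v = ∑ₛ (λ H → (v ∈? H ×-dec T? (G H)) ▸ 1)

≡true⇒T : {b : Bool} → b ≡ true → T b
≡true⇒T refl = tt

T⇒≡true : {b : Bool} → T b → b ≡ true
T⇒≡true {true} _ = refl

module Discharging {n k e : ℕ} (4c≤d : 4 * suc e ≤ suc k) (G : Family n)
  (down : DownClosed G) (bounded : ∀ H → T (G H) → ∣ H ∣ ≤ suc k)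
  (min-degree : ∀ v → 2 ^ k ≤ degree G v + e) where

  open Reciprocal (suc k) public

  -- `τ` is the required average share `(2 ^ d - c) / d` times `d * κ`. Sets missing from a small
  -- neighbourhood have at least `d - e` elements, so `p` is the largest value that `q` takes on
  -- them.
  d p τ : ℕ
  d = suc k
  p = q (d ∸ e)
  τ = κ * (2 ^ d ∸ suc e)

  3e+3≤k : 3 * e + 3 ≤ k
  3e+3≤k = ≤-trans (m≤m+n _ e) (s≤s⁻¹ (≤-trans (≤-reflexive (lemma e)) 4c≤d))
    where
    lemma : ∀ e → suc (3 * e + 3 + e) ≡ 4 * suc e
    lemma = solve-∀

  3≤k : 3 ≤ k
  3≤k = ≤-trans (m≤n+m 3 (3 * e)) 3e+3≤k

  2+e≤k : 2 + e ≤ k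
  2+e≤k = ≤-trans (≤-trans (m≤m+n (2 + e) (e + e + 1)) (≤-reflexive (lemma e))) 3e+3≤k
    where
    lemma : ∀ e → 2 + e + (e + e + 1) ≡ 3 * e + 3
    lemma = solve-∀

  e≤k : e ≤ k
  e≤k = ≤-trans (m≤n+m e 2) 2+e≤k

  e≤d : e ≤ d
  e≤d = m≤n⇒m≤1+n e≤k

  1≤d∸e : 1 ≤ d ∸ e
  1≤d∸e = m<n⇒0<n∸m (s≤s e≤k)

  e<2^k : e < 2 ^ k
  e<2^k = ≤-<-trans e≤k (n<2^n k)

  -- The left side is the weight of a vertex in a complete `d`-dimensional cube. Its margin over the
  -- target comes from `2 ^ d - 1 = (2 ^ d - c) + e` and pays `κ` for each of `e` missing sets.
  d*cube : d * cube k (q ∘ suc) ≡ τ + κ * e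
  d*cube = +-cancelʳ-≡ κ _ _ (begin
    d * cube k (q ∘ suc) + κ              ≡⟨ cube-q k ⟩
    2 ^ d * κ                             ≡⟨ cong (_* κ) (m∸n+n≡m e<2^d) ⟨
    (2 ^ d ∸ suc e + suc e) * κ           ≡⟨ lemma (2 ^ d ∸ suc e) e κ ⟩
    τ + κ * e + κ ∎)
    where
    open ≡-Reasoning
    e<2^d : e < 2 ^ d
    e<2^d = ≤-trans e<2^k (m≤m+n (2 ^ k) _)
    lemma : ∀ a e x → (a + suc e) * x ≡ x * a + x * e + x
    lemma = solve-∀

  N : Fin n → Subset n
  N v = tabulate (λ u → G (⁅ v ⁆ ∪ ⁅ u ⁆))

  ∈N⁺ : ∀ {u v} → T (G (⁅ v ⁆ ∪ ⁅ u ⁆)) → u ∈ N v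
  ∈N⁺ {u} {v} t = lookup⇒[]= u _ (trans (lookup∘tabulate _ u) (T⇒≡true t))

  ∈N⁻ : ∀ {u v} → u ∈ N v → T (G (⁅ v ⁆ ∪ ⁅ u ⁆))
  ∈N⁻ {u} {v} i = ≡true⇒T (trans (sym (lookup∘tabulate _ u)) ([]=⇒lookup i))

  N-sym : ∀ {u v} → u ∈ N v → v ∈ N u
  N-sym {u} {v} i = ∈N⁺ (subst (T ∘ G) (∪-comm ⁅ v ⁆ ⁅ u ⁆) (∈N⁻ i))

  edge⊆N : ∀ {v H} → v ∈ H → T (G H) → H ⊆ N v
  edge⊆N v∈H H∈G u∈H = ∈N⁺ (down (λ i → ∪-least (⁅⁆⊆ v∈H) (⁅⁆⊆ u∈H) i) H∈G)

  v∈N : ∀ v → v ∈ N v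
  v∈N v with T? (G ⁅ v ⁆)
  ... | yes t = edge⊆N (x∈⁅x⁆ v) t (x∈⁅x⁆ v)
  ... | no ¬t = contradiction (≤-trans (min-degree v) (≤-reflexive (cong (_+ e) deg≡0))) (<⇒≱ e<2^k)
    where
    deg≡0 : degree G v ≡ 0
    deg≡0 = trans (∑-cong (subsets n) (λ H → ▸-no (v ∈? H ×-dec T? (G H))
      (λ (v∈H , H∈G) → ¬t (down (⁅⁆⊆ v∈H) H∈G)))) (∑-zero (subsets n))

  -- All members through `v` lie in `N v`. With fewer than `d` vertices there are at most
  -- `2 ^ (k - 1)` of them, and `e < 2 ^ (k - 1)` cannot make up for the other half.
  d≤∣N∣ : ∀ v → d ≤ ∣ N v ∣
  d≤∣N∣ v with ∣ N v ∣ in eq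
  ... | zero = contradiction (≤-trans (≤-reflexive (sym (∣⁅x⁆∣≡1 v))) (p⊆q⇒∣p∣≤∣q∣ (⁅⁆⊆ (v∈N v))))
                 (<⇒≱ (≤-reflexive (cong suc eq)))
  ... | suc m with k ≤? m
  ...   | yes k≤m = s≤s k≤m
  ...   | no k≰m = contradiction (min-degree v) (<⇒≱ (begin-strict
    degree G v + e
      ≤⟨ +-monoˡ-≤ e (∑-mono (subsets n) (λ H → ▸-mono (v ∈? H ×-dec T? (G H)) (v ∈? H ×-dec H ⊆? N v)
           (λ (v∈H , H∈G) → v∈H , edge⊆N v∈H H∈G) (λ _ → ≤-refl))) ⟩
    ∑ₛ (λ H → (v ∈? H ×-dec H ⊆? N v) ▸ 1) + e
      ≡⟨ cong (_+ e) (trans (star v (N v) m (λ _ → 1) (v∈N v) eq) (trans (cube-1 m 1) (*-identityʳ (2 ^ m)))) ⟩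
    2 ^ m + e
      <⟨ +-mono-≤-< (^-monoʳ-≤ 2 m≤k-1) (≤-<-trans e≤k-1 (n<2^n (pred k))) ⟩
    2 ^ pred k + 2 ^ pred k
      ≡⟨ cong (2 ^ pred k +_) (+-identityʳ _) ⟨
    2 ^ suc (pred k)
      ≡⟨ cong (2 ^_) (suc-pred k {{>-nonZero (≤-trans (s≤s z≤n) 3≤k)}}) ⟩
    2 ^ k ∎))
    where
    open ≤-Reasoning
    m≤k-1 : m ≤ pred k
    m≤k-1 = ≤-pred (≤-trans (≰⇒> k≰m) (≤-reflexive (sym (suc-pred k {{>-nonZero (≤-trans (s≤s z≤n) 3≤k)}}))))
    e≤k-1 : e ≤ pred k
    e≤k-1 = pred-mono-≤ (≤-trans (n≤1+n (suc e)) 2+e≤k)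

  -- Small neighbourhoods, missing sets and payments

  Small : Fin n → Set
  Small v = ∣ N v ∣ ≤ d

  small? : ∀ v → Dec (Small v)
  small? v = ∣ N v ∣ ≤? d

  ∣N∣≡d : ∀ {v} → Small v → ∣ N v ∣ ≡ d
  ∣N∣≡d {v} small = ≤-antisym small (d≤∣N∣ v)

  Missing : Subset n → Subset n → Set
  Missing D H = H ⊆ D × ¬ T (G H)

  missing? : ∀ D H → Dec (Missing D H)
  missing? D H = H ⊆? D ×-dec ¬? (T? (G H))

  #missing : Subset n → ℕ
  #missing D = ∑ₛ (λ H → missing? D H ▸ 1)

  #missing-at : Fin n → Subset n → ℕ
  #missing-at v D = ∑ₛ (λ H → (v ∈? H ×-dec missing? D H) ▸ 1)

  star-split : ∀ v D (h : ℕ → ℕ) → v ∈ D → ∣ D ∣ ≡ d →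
    ∑ₛ (λ H → (v ∈? H ×-dec (H ⊆? D ×-dec T? (G H))) ▸ h ∣ H ∣)
      + ∑ₛ (λ H → (v ∈? H ×-dec missing? D H) ▸ h ∣ H ∣) ≡ cube k (h ∘ suc)
  star-split v D h v∈D eq = begin
    ∑ₛ (λ H → (v ∈? H ×-dec (H ⊆? D ×-dec T? (G H))) ▸ h ∣ H ∣)
      + ∑ₛ (λ H → (v ∈? H ×-dec missing? D H) ▸ h ∣ H ∣)
      ≡⟨ ∑-+ (subsets n) (λ H → (v ∈? H ×-dec (H ⊆? D ×-dec T? (G H))) ▸ h ∣ H ∣)
           (λ H → (v ∈? H ×-dec missing? D H) ▸ h ∣ H ∣) ⟨
    ∑ₛ (λ H → ((v ∈? H ×-dec (H ⊆? D ×-dec T? (G H))) ▸ h ∣ H ∣)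
      + ((v ∈? H ×-dec missing? D H) ▸ h ∣ H ∣))
      ≡⟨ ∑-cong (subsets n) (λ H → trans (cong₂ _+_
           (▸-cong (v ∈? H ×-dec (H ⊆? D ×-dec T? (G H))) ((v ∈? H ×-dec H ⊆? D) ×-dec T? (G H))
             (λ (a , b , c) → (a , b) , c) (λ ((a , b) , c) → a , b , c) (λ _ → refl))
           (▸-cong (v ∈? H ×-dec missing? D H) ((v ∈? H ×-dec H ⊆? D) ×-dec ¬? (T? (G H)))
             (λ (a , b , c) → (a , b) , c) (λ ((a , b) , c) → a , b , c) (λ _ → refl)))
           (sym (▸-split (v ∈? H ×-dec H ⊆? D) (T? (G H))))) ⟩
    ∑ₛ (λ H → (v ∈? H ×-dec H ⊆? D) ▸ h ∣ H ∣)
      ≡⟨ star v D k h v∈D eq ⟩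
    cube k (h ∘ suc) ∎
    where open ≡-Reasoning

  -- In `transfer D u v`, u pays and v is a small vertex with N v = D ∋ u.  If at most e subsets of D
  -- are missing, the cost of each missing H ∋ v is spread evenly: every vertex of D ─ H pays q ∣ H ∣
  -- to v.  Otherwise only big vertices pay, and D contains at least e of them.
  transfer-light : Subset n → Fin n → Fin n → ℕ
  transfer-light D u v = ∑ₛ (λ H → (v ∈? H ×-dec missing? D H) ▸ ¬? (u ∈? H) ▸ q ∣ H ∣)

  transfer-heavy : Fin n → ℕ
  transfer-heavy u = ¬? (small? u) ▸ (e * p)

  transfer : Subset n → Fin n → Fin n → ℕ
  transfer D u v = ((#missing D ≤? e) ▸ transfer-light D u v) + (¬? (#missing D ≤? e) ▸ transfer-heavy u)

  pay : Fin n → Fin n → ℕ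
  pay u v = (small? v ×-dec u ∈? N v) ▸ transfer (N v) u v

  weight incoming outgoing : Fin n → ℕ
  weight v = ∑ₛ (λ H → (v ∈? H ×-dec T? (G H)) ▸ (d * q ∣ H ∣))
  incoming v = ∑ᵥ (λ u → pay u v)
  outgoing v = ∑ᵥ (λ u → pay v u)

  transfer-if-light : ∀ {D} u v → #missing D ≤ e → transfer D u v ≡ transfer-light D u v
  transfer-if-light {D} u v light = trans
    (cong₂ _+_ (▸-yes (#missing D ≤? e) light) (▸-no (¬? (#missing D ≤? e)) λ ¬l → ¬l light))
    (+-identityʳ _)

  transfer-if-heavy : ∀ {D} u v → ¬ (#missing D ≤ e) → transfer D u v ≡ transfer-heavy u
  transfer-if-heavy {D} u v heavy =
    cong₂ _+_ (▸-no (#missing D ≤? e) heavy) (▸-yes (¬? (#missing D ≤? e)) heavy)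

  module SmallVertex {v : Fin n} (small : Small v) where

    star-split-N : ∀ (h : ℕ → ℕ) →
      ∑ₛ (λ H → (v ∈? H ×-dec T? (G H)) ▸ h ∣ H ∣)
        + ∑ₛ (λ H → (v ∈? H ×-dec missing? (N v) H) ▸ h ∣ H ∣) ≡ cube k (h ∘ suc)
    star-split-N h = trans
      (cong₂ _+_ (∑-cong (subsets n) (λ H →
        ▸-cong (v ∈? H ×-dec T? (G H)) (v ∈? H ×-dec (H ⊆? N v ×-dec T? (G H)))
          (λ (a , c) → a , (λ {x} → edge⊆N a c {x}) , c) (λ (a , b , c) → a , c) (λ _ → refl))) refl)
      (star-split v (N v) h (v∈N v) (∣N∣≡d small))

    missing-at≤e : #missing-at v (N v) ≤ e
    missing-at≤e = +-cancelˡ-≤ (degree G v) _ _ (begin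
      degree G v + #missing-at v (N v)    ≡⟨ star-split-N (λ _ → 1) ⟩
      cube k (λ _ → 1)                    ≡⟨ trans (cube-1 k 1) (*-identityʳ (2 ^ k)) ⟩
      2 ^ k                               ≤⟨ min-degree v ⟩
      degree G v + e                      ∎)
      where open ≤-Reasoning

    -- If `H` is missing, so are all `2 ^ m` sets between `H ∪ ⁅ v ⁆` and `N v`. They contain `v`,
    -- so `2 ^ m ≤ e` and thus `m < e`; this strictness pays for the element `v` that `H` itself may
    -- lack.
    missing-large : ∀ {H} → Missing (N v) H → d ≤ ∣ H ∣ + e
    missing-large {H} (H⊆N , H∉G) = begin
      d                          ≡⟨ d≡ ⟩
      m + ∣ Hᵥ ∣                  ≤⟨ +-monoʳ-≤ m (∣p∪⁅v⁆∣≤ v H) ⟩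
      m + suc ∣ H ∣              ≡⟨ +-suc m ∣ H ∣ ⟩
      suc m + ∣ H ∣              ≤⟨ +-monoˡ-≤ ∣ H ∣ (≤-trans (n<2^n m) 2^m≤e) ⟩
      e + ∣ H ∣                  ≡⟨ +-comm e ∣ H ∣ ⟩
      ∣ H ∣ + e                  ∎
      where
      open ≤-Reasoning
      Hᵥ = H ∪ ⁅ v ⁆
      Hᵥ⊆N : Hᵥ ⊆ N v
      Hᵥ⊆N = ∪-least H⊆N (⁅⁆⊆ (v∈N v))
      m = d ∸ ∣ Hᵥ ∣
      d≡ : d ≡ m + ∣ Hᵥ ∣
      d≡ = sym (m∸n+n≡m (≤-trans (p⊆q⇒∣p∣≤∣q∣ Hᵥ⊆N) small))
      2^m≤e : 2 ^ m ≤ e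
      2^m≤e = begin
        2 ^ m
          ≡⟨ trans (cube-1 m 1) (*-identityʳ (2 ^ m)) ⟨
        cube m (λ _ → 1)
          ≡⟨ ∑ₛ-interval Hᵥ (N v) m (λ _ → 1) Hᵥ⊆N (trans (∣N∣≡d small) d≡) ⟨
        ∑ₛ (λ X → (Hᵥ ⊆? X ×-dec X ⊆? N v) ▸ 1)
          ≤⟨ ∑-mono (subsets n) (λ X → ▸-mono (Hᵥ ⊆? X ×-dec X ⊆? N v) (v ∈? X ×-dec missing? (N v) X)
               (λ (Hᵥ⊆X , X⊆N) → Hᵥ⊆X (q⊆p∪q H ⁅ v ⁆ (x∈⁅x⁆ v)) , (λ {x} → X⊆N {x}) ,
                 λ X∈G → H∉G (down (λ i → Hᵥ⊆X (p⊆p∪q ⁅ v ⁆ i)) X∈G))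
               (λ _ → ≤-refl)) ⟩
        #missing-at v (N v)
          ≤⟨ missing-at≤e ⟩
        e ∎

    d∸e≤ : ∀ {H} → Missing (N v) H → d ∸ e ≤ ∣ H ∣
    d∸e≤ {H} miss = ≤-trans (∸-monoˡ-≤ e (missing-large miss)) (≤-reflexive (m+n∸n≡m ∣ H ∣ e))

    -- A pair inside `N v` has fewer than `d - e` elements, too few to be missing, so `N v` is a
    -- clique.
    N⊆N : ∀ {u} → u ∈ N v → N v ⊆ N u
    N⊆N {u} u∈N {z} z∈N with T? (G (⁅ u ⁆ ∪ ⁅ z ⁆))
    ... | yes t = ∈N⁺ t
    ... | no ¬t = contradiction (missing-large ((λ i → ∪-least (⁅⁆⊆ u∈N) (⁅⁆⊆ z∈N) i) , ¬t)) (<⇒≱ (begin-strict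
      ∣ ⁅ u ⁆ ∪ ⁅ z ⁆ ∣ + e       ≤⟨ +-monoˡ-≤ e (∣p∪⁅v⁆∣≤ z ⁅ u ⁆) ⟩
      suc ∣ ⁅ u ⁆ ∣ + e           ≡⟨ cong (λ x → suc x + e) (∣⁅x⁆∣≡1 u) ⟩
      2 + e                       <⟨ s≤s 2+e≤k ⟩
      d                           ∎))
      where open ≤-Reasoning

    -- Hence the number of missing sets, and with it the rule of payment, is common to all small
    -- vertices of one neighbourhood.
    twin : ∀ {u} → Small u → u ∈ N v → N v ≡ N u
    twin smallᵤ u∈N = ⊆∧∣≥∣⇒≡ (λ i → N⊆N u∈N i) (≤-trans smallᵤ (d≤∣N∣ v))

    missing-size : ∀ {H} → Missing (N v) H → 1 ≤ ∣ H ∣ × ∣ H ∣ ≤ d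
    missing-size miss = ≤-trans 1≤d∸e (d∸e≤ miss) , ≤-trans (p⊆q⇒∣p∣≤∣q∣ (proj₁ miss)) small

    q≤p : ∀ {H} → Missing (N v) H → q ∣ H ∣ ≤ p
    q≤p miss = q-antitone (d∸e≤ miss)

    transfer≤ : ∀ u → transfer (N v) u v ≤ e * p
    transfer≤ u = [ light , heavy ]′ (toSum (#missing (N v) ≤? e))
      where
      open ≤-Reasoning
      heavy : ¬ (#missing (N v) ≤ e) → transfer (N v) u v ≤ e * p
      heavy h = ≤-trans (≤-reflexive (transfer-if-heavy u v h)) (▸-≤ (¬? (small? u)) (λ _ → ≤-refl))
      light : #missing (N v) ≤ e → transfer (N v) u v ≤ e * p
      light l = begin
        transfer (N v) u v
          ≡⟨ transfer-if-light u v l ⟩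
        transfer-light (N v) u v
          ≤⟨ ∑-mono (subsets n) (λ H → ▸-mono (v ∈? H ×-dec missing? (N v) H) (v ∈? H ×-dec missing? (N v) H)
               (λ m → m) (λ (_ , m) → ▸-≤ (¬? (u ∈? H)) (λ _ → q≤p m))) ⟩
        ∑ₛ (λ H → (v ∈? H ×-dec missing? (N v) H) ▸ p)
          ≡⟨ ∑-const-▸ (subsets n) (λ H → v ∈? H ×-dec missing? (N v) H) p ⟩
        p * #missing-at v (N v)
          ≤⟨ *-monoʳ-≤ p missing-at≤e ⟩
        p * e
          ≡⟨ *-comm p e ⟩
        e * p ∎

    missing-weight : ℕ
    missing-weight = ∑ₛ (λ H → (v ∈? H ×-dec missing? (N v) H) ▸ (d * q ∣ H ∣))

    weight+missing : weight v + missing-weight ≡ τ + κ * e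
    weight+missing = trans (star-split-N (λ s → d * q s)) (trans (cube-*ˡ k d (q ∘ suc)) d*cube)

    module Light (light : #missing (N v) ≤ e) where

      #in #out : ℕ
      #in = #missing-at v (N v)
      #out = ∑ₛ (λ H → (missing? (N v) H ×-dec ¬? (v ∈? H)) ▸ 1)

      #in+#out : #in + #out ≡ #missing (N v)
      #in+#out = trans (sym (∑-+ (subsets n) _ _)) (∑-cong (subsets n) (λ H → trans
        (cong₂ _+_ (▸-cong (v ∈? H ×-dec missing? (N v) H) (missing? (N v) H ×-dec v ∈? H)
          (λ (a , b) → b , a) (λ (a , b) → b , a) (λ _ → refl)) refl)
        (sym (▸-split (missing? (N v) H) (v ∈? H)))))

      incoming≡ : incoming v ≡ ∑ₛ (λ H → (v ∈? H ×-dec missing? (N v) H) ▸ excess ∣ H ∣)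
      incoming≡ = begin
        ∑ᵥ (λ u → pay u v)
          ≡⟨ ∑-cong (vertices n) (λ u → ▸-cong (small? v ×-dec u ∈? N v) (u ∈? N v)
               proj₂ (small ,_) (λ _ → transfer-if-light u v light)) ⟩
        ∑ᵥ (λ u → (u ∈? N v) ▸ transfer-light (N v) u v)
          ≡⟨ ∑-cong (vertices n) (λ u → ∑-▸ (subsets n) (u ∈? N v) _) ⟨
        ∑ᵥ (λ u → ∑ₛ (λ H → (u ∈? N v) ▸ (v ∈? H ×-dec missing? (N v) H) ▸ ¬? (u ∈? H) ▸ q ∣ H ∣))
          ≡⟨ ∑-swap (vertices n) (subsets n) _ ⟩
        ∑ₛ (λ H → ∑ᵥ (λ u → (u ∈? N v) ▸ (v ∈? H ×-dec missing? (N v) H) ▸ ¬? (u ∈? H) ▸ q ∣ H ∣))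
          ≡⟨ ∑-cong (subsets n) inner ⟩
        ∑ₛ (λ H → (v ∈? H ×-dec missing? (N v) H) ▸ excess ∣ H ∣) ∎
        where
        open ≡-Reasoning
        inner : ∀ H → ∑ᵥ (λ u → (u ∈? N v) ▸ (v ∈? H ×-dec missing? (N v) H) ▸ ¬? (u ∈? H) ▸ q ∣ H ∣)
          ≡ (v ∈? H ×-dec missing? (N v) H) ▸ excess ∣ H ∣
        inner H = begin
          ∑ᵥ (λ u → (u ∈? N v) ▸ M? ▸ ¬? (u ∈? H) ▸ q ∣ H ∣)
            ≡⟨ ∑-cong (vertices n) (λ u → trans (▸-comm (u ∈? N v) M?)
                 (cong (M? ▸_) (▸-× (u ∈? N v) (¬? (u ∈? H))))) ⟩
          ∑ᵥ (λ u → M? ▸ (u ∈? N v ×-dec ¬? (u ∈? H)) ▸ q ∣ H ∣)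
            ≡⟨ ∑-▸ (vertices n) M? _ ⟩
          M? ▸ ∑ᵥ (λ u → (u ∈? N v ×-dec ¬? (u ∈? H)) ▸ q ∣ H ∣)
            ≡⟨ ▸-cong M? M? (λ m → m) (λ m → m) (λ (_ , H⊆N , _) → begin
                 ∑ᵥ (λ u → (u ∈? N v ×-dec ¬? (u ∈? H)) ▸ q ∣ H ∣)
                   ≡⟨ ∑-const-▸ (vertices n) (λ u → u ∈? N v ×-dec ¬? (u ∈? H)) (q ∣ H ∣) ⟩
                 q ∣ H ∣ * ∑ᵥ (λ u → (u ∈? N v ×-dec ¬? (u ∈? H)) ▸ 1)
                   ≡⟨ cong (q ∣ H ∣ *_) (trans (∑-diff H (N v) H⊆N) (cong (_∸ ∣ H ∣) (∣N∣≡d small))) ⟩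
                 q ∣ H ∣ * (d ∸ ∣ H ∣)
                   ≡⟨ *-comm (q ∣ H ∣) _ ⟩
                 excess ∣ H ∣ ∎) ⟩
          M? ▸ excess ∣ H ∣ ∎
          where
          M? = v ∈? H ×-dec missing? (N v) H

      missing-weight≡ : missing-weight ≡ κ * #in + incoming v
      missing-weight≡ = begin
        ∑ₛ (λ H → (v ∈? H ×-dec missing? (N v) H) ▸ (d * q ∣ H ∣))
          ≡⟨ ∑-cong (subsets n) (λ H → let M? = v ∈? H ×-dec missing? (N v) H in
               trans (▸-cong M? M? (λ m → m) (λ m → m)
                 (λ (_ , m) → let a , b = missing-size m in q-split ∣ H ∣ a b)) (▸-+ M?)) ⟩
        ∑ₛ (λ H → ((v ∈? H ×-dec missing? (N v) H) ▸ κ) + ((v ∈? H ×-dec missing? (N v) H) ▸ excess ∣ H ∣))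
          ≡⟨ ∑-+ (subsets n) _ _ ⟩
        ∑ₛ (λ H → (v ∈? H ×-dec missing? (N v) H) ▸ κ) + ∑ₛ (λ H → (v ∈? H ×-dec missing? (N v) H) ▸ excess ∣ H ∣)
          ≡⟨ cong₂ _+_ (∑-const-▸ (subsets n) (λ H → v ∈? H ×-dec missing? (N v) H) κ) (sym incoming≡) ⟩
        κ * #in + incoming v ∎
        where open ≡-Reasoning

      -- A missing `H` that avoids `v` makes `v` pay `q ∣ H ∣` to at most `∣ H ∣` vertices, which is
      -- `κ` at most.
      outgoing≤ : outgoing v ≤ κ * #out
      outgoing≤ = begin
        ∑ᵥ (λ u → pay v u)
          ≤⟨ ∑-mono (vertices n) (λ u → ▸-≤ (small? u ×-dec v ∈? N u) λ (smallᵤ , v∈N) →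
               ≤-reflexive (trans (cong (λ D → transfer D v u) (sym (twin smallᵤ (N-sym v∈N))))
                 (transfer-if-light v u light))) ⟩
        ∑ᵥ (λ u → transfer-light (N v) v u)
          ≡⟨ ∑-swap (vertices n) (subsets n) _ ⟩
        ∑ₛ (λ H → ∑ᵥ (λ u → (u ∈? H ×-dec missing? (N v) H) ▸ ¬? (v ∈? H) ▸ q ∣ H ∣))
          ≤⟨ ∑-mono (subsets n) inner ⟩
        ∑ₛ (λ H → (missing? (N v) H ×-dec ¬? (v ∈? H)) ▸ κ)
          ≡⟨ ∑-const-▸ (subsets n) (λ H → missing? (N v) H ×-dec ¬? (v ∈? H)) κ ⟩
        κ * #out ∎
        where
        open ≤-Reasoning
        inner : ∀ H → ∑ᵥ (λ u → (u ∈? H ×-dec missing? (N v) H) ▸ ¬? (v ∈? H) ▸ q ∣ H ∣)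
          ≤ (missing? (N v) H ×-dec ¬? (v ∈? H)) ▸ κ
        inner H = begin
          ∑ᵥ (λ u → (u ∈? H ×-dec missing? (N v) H) ▸ ¬? (v ∈? H) ▸ q ∣ H ∣)
            ≡⟨ ∑-cong (vertices n) (λ u → trans (sym (▸-× (u ∈? H) (missing? (N v) H)))
                 (trans (cong ((u ∈? H) ▸_) (▸-× (missing? (N v) H) (¬? (v ∈? H)))) (▸-comm (u ∈? H) M?))) ⟩
          ∑ᵥ (λ u → M? ▸ (u ∈? H) ▸ q ∣ H ∣)
            ≡⟨ ∑-▸ (vertices n) M? _ ⟩
          M? ▸ ∑ᵥ (λ u → (u ∈? H) ▸ q ∣ H ∣)
            ≤⟨ ▸-mono M? M? (λ m → m) (λ (m , _) → let a , b = missing-size m in ≤-reflexive (trans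
                 (∑-const-▸ (vertices n) (_∈? H) (q ∣ H ∣))
                 (trans (cong (q ∣ H ∣ *_) (sym (∣p∣≡∑ H))) (trans (*-comm (q ∣ H ∣) _) (q-exact ∣ H ∣ a b))))) ⟩
          M? ▸ κ ∎
          where
          M? = missing? (N v) H ×-dec ¬? (v ∈? H)

      -- The target allows `e` missing sets at `v`, of which `#in` occur. Incoming payments cover
      -- their excess, and the other `e - #in ≥ #out` allowances of `κ` cover what `v` pays.
      balance : τ + outgoing v ≤ weight v + incoming v
      balance = +-cancelʳ-≤ (κ * #in) _ _ (begin
        τ + outgoing v + κ * #in                ≤⟨ +-monoˡ-≤ (κ * #in) (+-monoʳ-≤ τ outgoing≤) ⟩
        τ + κ * #out + κ * #in                    ≡⟨ lemma₁ τ κ #in #out ⟩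
        τ + κ * (#in + #out)                      ≡⟨ cong (λ x → τ + κ * x) #in+#out ⟩
        τ + κ * #missing (N v)                ≤⟨ +-monoʳ-≤ τ (*-monoʳ-≤ κ light) ⟩
        τ + κ * e                             ≡⟨ weight+missing ⟨
        weight v + missing-weight             ≡⟨ cong (weight v +_) missing-weight≡ ⟩
        weight v + (κ * #in + incoming v)       ≡⟨ lemma₂ (weight v) (κ * #in) (incoming v) ⟩
        weight v + incoming v + κ * #in         ∎)
        where
        open ≤-Reasoning
        lemma₁ : ∀ t x a b → t + x * b + x * a ≡ t + x * (a + b)
        lemma₁ = solve-∀
        lemma₂ : ∀ w a i → w + (a + i) ≡ w + i + a
        lemma₂ = solve-∀

  -- Numerical consequences of `4 * c ≤ d`

  d*p : d * p ≡ κ + e * p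
  d*p = trans (q-split (d ∸ e) 1≤d∸e (m∸n≤m d e)) (cong (λ x → κ + x * p) (m∸[m∸n]≡n e≤d))

  f : ℕ
  f = d ∸ 4 * suc e

  d≡ : d ≡ 4 * suc e + f
  d≡ = sym (m+[n∸m]≡n 4c≤d)

  d∸e≡ : d ∸ e ≡ 3 * e + 4 + f
  d∸e≡ = trans (cong (_∸ e) (trans d≡ (lemma e f))) (m+n∸m≡n e _)
    where
    lemma : ∀ e f → 4 * suc e + f ≡ e + (3 * e + 4 + f)
    lemma = solve-∀

  d∸2≡ : d ∸ 2 ≡ 4 * e + 2 + f
  d∸2≡ = trans (cong (_∸ 2) (trans d≡ (lemma e f))) (m+n∸m≡n 2 _)
    where
    lemma : ∀ e f → 4 * suc e + f ≡ 2 + (4 * e + 2 + f)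
    lemma = solve-∀

  [d∸e]*p≡κ : (d ∸ e) * p ≡ κ
  [d∸e]*p≡κ = q-exact (d ∸ e) 1≤d∸e (m∸n≤m d e)

  -- Multiplying by `d - e` turns `p` into `κ = 2 * q 2` and leaves a polynomial inequality. After
  -- substituting `d = 4 * suc e + f`, the difference of the two sides has no negative coefficient;
  -- it is the summand added in the middle. To leading order, with `d = a * e`, the inequality reads
  -- `(a - 4) * (a + 1) ≥ 0`, which is where the factor 4 is used up.
  near-bound : (d + 2 * e) * (e * p) ≤ excess 2
  near-bound = *-cancelˡ-≤ (d ∸ e) {{>-nonZero 1≤d∸e}} (begin
    (d ∸ e) * ((d + 2 * e) * (e * p))         ≡⟨ lemma₁ (d ∸ e) (d + 2 * e) e p ⟩
    (d + 2 * e) * e * ((d ∸ e) * p)           ≡⟨ cong ((d + 2 * e) * e *_) (trans [d∸e]*p≡κ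
                                                   (sym (q-exact 2 (s≤s z≤n) (s≤s (≤-trans (s≤s z≤n) 3≤k))))) ⟩
    (d + 2 * e) * e * (2 * q 2)               ≡⟨ cong (λ x → (x + 2 * e) * e * (2 * q 2)) d≡ ⟩
    (4 * suc e + f + 2 * e) * e * (2 * q 2)   ≤⟨ m≤m+n _ _ ⟩
    (4 * suc e + f + 2 * e) * e * (2 * q 2) + (14 * e + 5 * e * f + 8 + 6 * f + f * f) * q 2
                                              ≡⟨ lemma₂ e f (q 2) ⟩
    (3 * e + 4 + f) * ((4 * e + 2 + f) * q 2) ≡⟨ cong₂ (λ x y → x * (y * q 2)) d∸e≡ d∸2≡ ⟨
    (d ∸ e) * excess 2                        ∎)
    where
    open ≤-Reasoning
    lemma₁ : ∀ s a e p → s * (a * (e * p)) ≡ a * e * (s * p)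
    lemma₁ = solve-∀
    lemma₂ : ∀ e f x → (4 * suc e + f + 2 * e) * e * (2 * x) + (14 * e + 5 * e * f + 8 + 6 * f + f * f) * x
      ≡ (3 * e + 4 + f) * ((4 * e + 2 + f) * x)
    lemma₂ = solve-∀

  δ : ℕ
  δ = q 2 ∸ q 3

  q2≡ : q 2 ≡ q 3 + δ
  q2≡ = sym (m+[n∸m]≡n (q-antitone (s≤s (s≤s (z≤n {1})))))

  κ≡6δ : κ ≡ 6 * δ
  κ≡6δ = trans (sym 3q3) (trans (cong (3 *_) q3≡) (lemma δ))
    where
    3q3 : 3 * q 3 ≡ κ
    3q3 = q-exact 3 (s≤s z≤n) (≤-trans 3≤k (n≤1+n k))
    lemma : ∀ x → 3 * (2 * x) ≡ 6 * x
    lemma = solve-∀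
    lemma₁ : ∀ x → 2 * x + x ≡ 3 * x
    lemma₁ = solve-∀
    q3≡ : q 3 ≡ 2 * δ
    q3≡ = +-cancelˡ-≡ (2 * q 3) _ _ (trans (lemma₁ (q 3)) (trans 3q3
      (trans (sym (q-exact 2 (s≤s z≤n) (s≤s (≤-trans (s≤s z≤n) 3≤k))))
        (trans (cong (2 *_) q2≡) (*-distribˡ-+ 2 (q 3) δ)))))

  -- Compares the deficit that Katona's bound leaves at a far vertex with the gain from one
  -- additional neighbour. As in `near-bound`, multiplication by `d - e` removes `p`, and
  -- `κ = 6 * δ` reduces the claim to `6 * e * e ≤ (d - e) * d`.
  far-bound : e * (e * p) ≤ d * δ
  far-bound = *-cancelˡ-≤ (d ∸ e) {{>-nonZero 1≤d∸e}} (begin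
    (d ∸ e) * (e * (e * p))        ≡⟨ lemma₁ (d ∸ e) e p ⟩
    e * e * ((d ∸ e) * p)          ≡⟨ cong (e * e *_) (trans [d∸e]*p≡κ κ≡6δ) ⟩
    e * e * (6 * δ)                ≤⟨ m≤m+n _ _ ⟩
    e * e * (6 * δ) + (6 * e * e + 28 * e + 7 * e * f + 16 + 8 * f + f * f) * δ
                                   ≡⟨ lemma₂ e f δ ⟩
    (3 * e + 4 + f) * ((4 * suc e + f) * δ) ≡⟨ cong₂ (λ x y → x * (y * δ)) d∸e≡ d≡ ⟨
    (d ∸ e) * (d * δ)              ∎)
    where
    open ≤-Reasoning
    lemma₁ : ∀ s e p → s * (e * (e * p)) ≡ e * e * (s * p)
    lemma₁ = solve-∀
    lemma₂ : ∀ e f x → e * e * (6 * x) + (6 * e * e + 28 * e + 7 * e * f + 16 + 8 * f + f * f) * x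
      ≡ (3 * e + 4 + f) * ((4 * suc e + f) * x)
    lemma₂ = solve-∀

  -- Small vertices whose neighbourhood misses more than `e` sets

  module Heavy {v : Fin n} (small : Small v) (heavy : ¬ (#missing (N v) ≤ e)) where
    open SmallVertex small

    outgoing≤0 : outgoing v ≤ 0
    outgoing≤0 = ≤-trans (∑-mono (vertices n) (λ u → ▸-≤ (small? u ×-dec v ∈? N u) λ (smallᵤ , v∈N) →
      ≤-reflexive (trans (cong (λ D → transfer D v u) (sym (twin smallᵤ (N-sym v∈N))))
        (trans (transfer-if-heavy v u heavy) (▸-no (¬? (small? v)) λ ¬s → ¬s small)))))
      (≤-reflexive (∑-zero (vertices n)))

    N-without : Fin n → Subset n
    N-without u = N v ∩ ∁ ⁅ u ⁆

    -- If `N v` without `u` were in `G`, every missing set would contain `u`, and a small vertex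
    -- lies in at most `e` of them.
    without-missing : ∀ {u} → Small u → u ∈ N v → ¬ T (G (N-without u))
    without-missing {u} smallᵤ u∈N t = heavy (begin
      #missing (N v)
        ≤⟨ ∑-mono (subsets n) (λ H → ▸-mono (missing? (N v) H) (u ∈? H ×-dec missing? (N v) H)
             (λ m → u∈H m , m) (λ _ → ≤-refl)) ⟩
      #missing-at u (N v)
        ≡⟨ cong (#missing-at u) (twin smallᵤ u∈N) ⟩
      #missing-at u (N u)
        ≤⟨ SmallVertex.missing-at≤e smallᵤ ⟩
      e ∎)
      where
      open ≤-Reasoning
      u∈H : ∀ {H} → Missing (N v) H → u ∈ H
      u∈H {H} (H⊆N , H∉G) with u ∈? H
      ... | yes u∈H = u∈H
      ... | no u∉H = contradiction (down (λ {x} x∈H → x∈p∩q⁺ (H⊆N x∈H , x∉p⇒x∈∁p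
              (λ x∈u → u∉H (subst (_∈ H) (x∈⁅y⁆⇒x≡y u x∈u) x∈H)))) t) H∉G

    k≤∣N-without∣ : ∀ {u} → u ∈ N v → k ≤ ∣ N-without u ∣
    k≤∣N-without∣ {u} u∈N = begin
      k                              ≡⟨ cong (_∸ 1) (∣N∣≡d small) ⟨
      ∣ N v ∣ ∸ 1                    ≡⟨ cong (∣ N v ∣ ∸_) removed ⟨
      ∣ N v ∣ ∸ (∣ N v ∣ ∸ ∣ X ∣)    ≡⟨ m∸[m∸n]≡n (p⊆q⇒∣p∣≤∣q∣ X⊆N) ⟩
      ∣ X ∣                          ∎
      where
      open ≤-Reasoning
      X = N-without u
      X⊆N : X ⊆ N v
      X⊆N = p∩q⊆p (N v) (∁ ⁅ u ⁆)
      removed : ∣ N v ∣ ∸ ∣ X ∣ ≡ 1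
      removed = trans (sym (∑-diff X (N v) X⊆N)) (trans
        (∑-cong (vertices n) (λ x → ▸-cong (x ∈? N v ×-dec ¬? (x ∈? X)) (x ∈? ⁅ u ⁆)
          (λ (x∈N , x∉X) → x∉∁p⇒x∈p (λ x∈∁ → x∉X (x∈p∩q⁺ (x∈N , x∈∁))))
          (λ x∈u → ⁅⁆⊆ u∈N x∈u , λ x∈X → x∈p⇒x∉∁p x∈u (proj₂ (x∈p∩q⁻ (N v) _ x∈X))) (λ _ → refl)))
        (trans (sym (∣p∣≡∑ ⁅ u ⁆)) (∣⁅x⁆∣≡1 u)))

    #small #big : ℕ
    #small = ∑ᵥ (λ u → (u ∈? N v ×-dec small? u) ▸ 1)
    #big = ∑ᵥ (λ u → (u ∈? N v ×-dec ¬? (small? u)) ▸ 1)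

    -- Each small `u` other than `v` yields the missing set `N-without u` through `v`, and there are
    -- at most `e` such sets. The condition `k ≤ ∣ H ∣` ensures that one set accounts for one vertex
    -- only.
    #small≤ : #small ≤ 1 + e
    #small≤ = begin
      ∑ᵥ (λ u → (u ∈? N v ×-dec small? u) ▸ 1)
        ≤⟨ ∑-mono (vertices n) (λ u → ≤-trans (≤-reflexive (▸-split (u ∈? N v ×-dec small? u) (u ∈? ⁅ v ⁆)))
             (+-monoˡ-≤ _ (▸-mono ((u ∈? N v ×-dec small? u) ×-dec u ∈? ⁅ v ⁆) (u ∈? ⁅ v ⁆) proj₂ (λ _ → ≤-refl)))) ⟩
      ∑ᵥ (λ u → ((u ∈? ⁅ v ⁆) ▸ 1) + (R? u ▸ 1))
        ≡⟨ ∑-+ (vertices n) _ _ ⟩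
      ∑ᵥ (λ u → (u ∈? ⁅ v ⁆) ▸ 1) + ∑ᵥ (λ u → R? u ▸ 1)
        ≡⟨ cong (_+ ∑ᵥ (λ u → R? u ▸ 1)) (trans (sym (∣p∣≡∑ ⁅ v ⁆)) (∣⁅x⁆∣≡1 v)) ⟩
      1 + ∑ᵥ (λ u → R? u ▸ 1)
        ≤⟨ s≤s (∑-witness R? M? (λ H u → u ∈? N v ×-dec ¬? (u ∈? H)) 1 witness) ⟩
      1 + ∑ₛ (λ H → M? H ▸ ∑ᵥ (λ u → (u ∈? N v ×-dec ¬? (u ∈? H)) ▸ 1))
        ≤⟨ s≤s (∑-mono (subsets n) (λ H → ▸-mono (M? H) (v ∈? H ×-dec missing? (N v) H) proj₁
             (λ ((_ , H⊆N , _) , k≤H) → begin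
               ∑ᵥ (λ u → (u ∈? N v ×-dec ¬? (u ∈? H)) ▸ 1)   ≡⟨ ∑-diff H (N v) H⊆N ⟩
               ∣ N v ∣ ∸ ∣ H ∣                               ≤⟨ ∸-mono small k≤H ⟩
               suc k ∸ k                                     ≡⟨ m+n∸n≡m 1 k ⟩
               1                                             ∎))) ⟩
      1 + #missing-at v (N v)
        ≤⟨ s≤s missing-at≤e ⟩
      1 + e ∎
      where
      open ≤-Reasoning
      R? = λ u → (u ∈? N v ×-dec small? u) ×-dec ¬? (u ∈? ⁅ v ⁆)
      M? = λ H → (v ∈? H ×-dec missing? (N v) H) ×-dec (k ≤? ∣ H ∣)
      witness : ∀ u → (u ∈ N v × Small u) × u ∉ ⁅ v ⁆ →
        ∃ λ H → ((v ∈ H × Missing (N v) H) × k ≤ ∣ H ∣) × (u ∈ N v × u ∉ H)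
      witness u ((u∈N , smallᵤ) , u∉v) = N-without u ,
        ((x∈p∩q⁺ (v∈N v , x∉p⇒x∈∁p (λ v∈u → u∉v (subst (_∈ ⁅ v ⁆) (x∈⁅y⁆⇒x≡y u v∈u) (x∈⁅x⁆ v)))) ,
          (λ i → p∩q⊆p (N v) (∁ ⁅ u ⁆) i) , without-missing smallᵤ u∈N) , k≤∣N-without∣ u∈N) ,
        u∈N , λ i → x∈p⇒x∉∁p (x∈⁅x⁆ u) (proj₂ (x∈p∩q⁻ (N v) _ i))

    e≤#big : e ≤ #big
    e≤#big = +-cancelˡ-≤ (1 + e) _ _ (begin
      1 + e + e            ≤⟨ m≤m+n _ _ ⟩
      1 + e + e + (2 * e + 3 + f) ≡⟨ lemma e f ⟩
      4 * suc e + f        ≡⟨ d≡ ⟨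
      d                    ≡⟨ ∣N∣≡d small ⟨
      ∣ N v ∣              ≡⟨ trans (∣p∣≡∑ (N v)) (trans (∑-cong (vertices n) (λ u → ▸-split (u ∈? N v) (small? u)))
                                (∑-+ (vertices n) _ _)) ⟩
      #small + #big        ≤⟨ +-monoˡ-≤ #big #small≤ ⟩
      1 + e + #big         ∎)
      where
      open ≤-Reasoning
      lemma : ∀ e f → 1 + e + e + (2 * e + 3 + f) ≡ 4 * suc e + f
      lemma = solve-∀

    incoming≡ : incoming v ≡ e * p * #big
    incoming≡ = trans (∑-cong (vertices n) (λ u → trans
      (▸-cong (small? v ×-dec u ∈? N v) (u ∈? N v) proj₂ (small ,_) (λ _ → transfer-if-heavy u v heavy))
      (▸-× (u ∈? N v) (¬? (small? u)))))
      (∑-const-▸ (vertices n) (λ u → u ∈? N v ×-dec ¬? (small? u)) (e * p))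

    -- Each of at most `e` missing sets costs at most `d * p = κ + e * p`, and each of at least `e`
    -- big vertices in `N v` pays `e * p`.
    missing-weight≤ : missing-weight ≤ κ * e + incoming v
    missing-weight≤ = begin
      missing-weight
        ≤⟨ ∑-mono (subsets n) (λ H → let M? = v ∈? H ×-dec missing? (N v) H in
             ▸-mono M? M? (λ m → m) (λ (_ , m) → *-monoʳ-≤ d (q≤p m))) ⟩
      ∑ₛ (λ H → (v ∈? H ×-dec missing? (N v) H) ▸ (d * p))
        ≡⟨ ∑-const-▸ (subsets n) (λ H → v ∈? H ×-dec missing? (N v) H) (d * p) ⟩
      d * p * #missing-at v (N v)
        ≤⟨ *-monoʳ-≤ (d * p) missing-at≤e ⟩
      d * p * e
        ≡⟨ trans (cong (_* e) d*p) (*-distribʳ-+ e κ (e * p)) ⟩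
      κ * e + e * p * e
        ≤⟨ +-monoʳ-≤ (κ * e) (*-monoʳ-≤ (e * p) e≤#big) ⟩
      κ * e + e * p * #big
        ≡⟨ cong (κ * e +_) incoming≡ ⟨
      κ * e + incoming v ∎
      where open ≤-Reasoning

    balance : τ + outgoing v ≤ weight v + incoming v
    balance = +-cancelʳ-≤ (κ * e) _ _ (begin
      τ + outgoing v + κ * e                 ≤⟨ +-monoˡ-≤ (κ * e) (+-monoʳ-≤ τ outgoing≤0) ⟩
      τ + 0 + κ * e                          ≡⟨ cong (_+ κ * e) (+-identityʳ τ) ⟩
      τ + κ * e                              ≡⟨ weight+missing ⟨
      weight v + missing-weight              ≤⟨ +-monoʳ-≤ (weight v) missing-weight≤ ⟩
      weight v + (κ * e + incoming v)        ≡⟨ lemma (weight v) (κ * e) (incoming v) ⟩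
      weight v + incoming v + κ * e          ∎)
      where
      open ≤-Reasoning
      lemma : ∀ w a i → w + (a + i) ≡ w + i + a
      lemma = solve-∀

  -- Big vertices, with and without a small neighbour

  edge-size : ∀ {y H} → y ∈ H → T (G H) → 1 ≤ ∣ H ∣ × ∣ H ∣ ≤ d
  edge-size {y} {H} y∈H H∈G =
    ≤-trans (≤-reflexive (sym (∣⁅x⁆∣≡1 y))) (p⊆q⇒∣p∣≤∣q∣ (⁅⁆⊆ y∈H)) , bounded H H∈G

  module Near {v y : Fin n} (small : Small v) (big : ¬ Small y) (y∈N : y ∈ N v) where
    open SmallVertex small

    r : ℕ
    r = ∣ N y ∣ ∸ ∣ N v ∣

    ∣Ny∣≡ : ∣ N y ∣ ≡ d + r
    ∣Ny∣≡ = sym (trans (cong (λ x → d + (∣ N y ∣ ∸ x)) (∣N∣≡d small)) (m+[n∸m]≡n (d≤∣N∣ y)))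

    1≤r : 1 ≤ r
    1≤r = m<n⇒0<n∸m (≤-trans (s≤s small) (≰⇒> big))

    outgoing≤ : outgoing y ≤ (k + r) * (e * p)
    outgoing≤ = begin
      ∑ᵥ (λ u → pay y u)
        ≤⟨ ∑-mono (vertices n) (λ u → ▸-mono (small? u ×-dec y ∈? N u) (u ∈? N y ×-dec ¬? (u ∈? ⁅ y ⁆))
             (λ (smallᵤ , y∈Nu) → N-sym y∈Nu ,
               λ u∈y → big (subst Small (x∈⁅y⁆⇒x≡y y u∈y) smallᵤ))
             (λ (smallᵤ , _) → SmallVertex.transfer≤ smallᵤ y)) ⟩
      ∑ᵥ (λ u → (u ∈? N y ×-dec ¬? (u ∈? ⁅ y ⁆)) ▸ (e * p))
        ≡⟨ ∑-const-▸ (vertices n) (λ u → u ∈? N y ×-dec ¬? (u ∈? ⁅ y ⁆)) (e * p) ⟩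
      e * p * ∑ᵥ (λ u → (u ∈? N y ×-dec ¬? (u ∈? ⁅ y ⁆)) ▸ 1)
        ≡⟨ cong (e * p *_) (trans (∑-diff ⁅ y ⁆ (N y) (⁅⁆⊆ (v∈N y))) (cong₂ _∸_ ∣Ny∣≡ (∣⁅x⁆∣≡1 y))) ⟩
      e * p * (k + r)
        ≡⟨ *-comm (e * p) (k + r) ⟩
      (k + r) * (e * p) ∎
      where open ≤-Reasoning

    within without absent : ℕ
    within = ∑ₛ (λ H → (y ∈? H ×-dec (H ⊆? N v ×-dec T? (G H))) ▸ excess ∣ H ∣)
    without = ∑ₛ (λ H → ((y ∈? H ×-dec T? (G H)) ×-dec ¬? (H ⊆? N v)) ▸ excess ∣ H ∣)
    absent = ∑ₛ (λ H → (y ∈? H ×-dec missing? (N v) H) ▸ excess ∣ H ∣)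

    weight≡ : weight y ≡ κ * degree G y + (within + without)
    weight≡ = begin
      ∑ₛ (λ H → (y ∈? H ×-dec T? (G H)) ▸ (d * q ∣ H ∣))
        ≡⟨ ∑-cong (subsets n) (λ H → let E? = y ∈? H ×-dec T? (G H) in
             trans (▸-cong E? E? (λ m → m) (λ m → m)
               (λ (y∈H , H∈G) → let a , b = edge-size y∈H H∈G in q-split ∣ H ∣ a b)) (▸-+ E?)) ⟩
      ∑ₛ (λ H → ((y ∈? H ×-dec T? (G H)) ▸ κ) + ((y ∈? H ×-dec T? (G H)) ▸ excess ∣ H ∣))
        ≡⟨ ∑-+ (subsets n) _ _ ⟩
      ∑ₛ (λ H → (y ∈? H ×-dec T? (G H)) ▸ κ) + ∑ₛ (λ H → (y ∈? H ×-dec T? (G H)) ▸ excess ∣ H ∣)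
        ≡⟨ cong₂ _+_ (∑-const-▸ (subsets n) (λ H → y ∈? H ×-dec T? (G H)) κ)
             (trans (∑-cong (subsets n) (λ H → trans (▸-split (y ∈? H ×-dec T? (G H)) (H ⊆? N v))
               (cong₂ _+_ (▸-cong ((y ∈? H ×-dec T? (G H)) ×-dec H ⊆? N v) (y ∈? H ×-dec (H ⊆? N v ×-dec T? (G H)))
                 (λ ((a , b) , c) → a , c , b) (λ (a , c , b) → (a , b) , c) (λ _ → refl)) refl)))
               (∑-+ (subsets n) _ _)) ⟩
      κ * degree G y + (within + without) ∎
      where open ≡-Reasoning

    r*excess≤without : r * excess 2 ≤ without
    r*excess≤without = begin
      r * excess 2
        ≡⟨ *-comm r _ ⟩
      excess 2 * r
        ≡⟨ cong (excess 2 *_) (∑-diff (N v) (N y) (N⊆N y∈N)) ⟨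
      excess 2 * ∑ᵥ (λ u → (u ∈? N y ×-dec ¬? (u ∈? N v)) ▸ 1)
        ≡⟨ ∑-const-▸ (vertices n) (λ u → u ∈? N y ×-dec ¬? (u ∈? N v)) (excess 2) ⟨
      ∑ᵥ (λ u → (u ∈? N y ×-dec ¬? (u ∈? N v)) ▸ excess 2)
        ≤⟨ ∑-witness (λ u → u ∈? N y ×-dec ¬? (u ∈? N v)) E? (λ H u → u ∈? H ×-dec ¬? (u ∈? ⁅ y ⁆)) (excess 2) witness ⟩
      ∑ₛ (λ H → E? H ▸ ∑ᵥ (λ u → (u ∈? H ×-dec ¬? (u ∈? ⁅ y ⁆)) ▸ excess 2))
        ≤⟨ ∑-mono (subsets n) (λ H → ▸-mono (E? H) ((y ∈? H ×-dec T? (G H)) ×-dec ¬? (H ⊆? N v)) proj₁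
             (λ (((y∈H , _) , _) , ∣H∣≡2) → ≤-reflexive (begin-equality
               ∑ᵥ (λ u → (u ∈? H ×-dec ¬? (u ∈? ⁅ y ⁆)) ▸ excess 2)
                 ≡⟨ ∑-const-▸ (vertices n) (λ u → u ∈? H ×-dec ¬? (u ∈? ⁅ y ⁆)) (excess 2) ⟩
               excess 2 * ∑ᵥ (λ u → (u ∈? H ×-dec ¬? (u ∈? ⁅ y ⁆)) ▸ 1)
                 ≡⟨ cong (excess 2 *_) (trans (∑-diff ⁅ y ⁆ H (⁅⁆⊆ y∈H)) (cong₂ _∸_ ∣H∣≡2 (∣⁅x⁆∣≡1 y))) ⟩
               excess 2 * 1
                 ≡⟨ *-identityʳ _ ⟩
               excess 2
                 ≡⟨ cong excess ∣H∣≡2 ⟨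
               excess ∣ H ∣ ∎))) ⟩
      without ∎
      where
      open ≤-Reasoning
      -- Restricting to pairs leaves each `H` exactly one vertex besides `y`, so no excess is
      -- counted twice.
      E? = λ H → ((y ∈? H ×-dec T? (G H)) ×-dec ¬? (H ⊆? N v)) ×-dec (∣ H ∣ ≟ 2)
      witness : ∀ u → u ∈ N y × u ∉ N v →
        ∃ λ H → (((y ∈ H × T (G H)) × ¬ (H ⊆ N v)) × ∣ H ∣ ≡ 2) × (u ∈ H × u ∉ ⁅ y ⁆)
      witness u (u∈N , u∉N) = ⁅ y ⁆ ∪ ⁅ u ⁆ ,
        (((p⊆p∪q ⁅ u ⁆ (x∈⁅x⁆ y) , ∈N⁻ u∈N) , λ ⊆N → u∉N (⊆N u∈H)) ,
          trans (∣p∪⁅v⁆∣ u ⁅ y ⁆ u∉y) (cong suc (∣⁅x⁆∣≡1 y))) , u∈H , u∉y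
        where
        u∈H : u ∈ ⁅ y ⁆ ∪ ⁅ u ⁆
        u∈H = q⊆p∪q ⁅ y ⁆ ⁅ u ⁆ (x∈⁅x⁆ u)
        u∉y : u ∉ ⁅ y ⁆
        u∉y u∈y = u∉N (⁅⁆⊆ y∈N u∈y)

    -- Adding `v` maps the missing sets that avoid `v` injectively to missing sets that contain it,
    -- and there are at most `e` of the latter.
    #missing≤2e : #missing (N v) ≤ 2 * e
    #missing≤2e = begin
      #missing (N v)
        ≡⟨ ∑-cong (subsets n) (λ H → trans (▸-split (missing? (N v) H) (v ∈? H)) (cong₂ _+_
             (▸-cong (missing? (N v) H ×-dec v ∈? H) (v ∈? H ×-dec missing? (N v) H)
               (λ (a , b) → b , a) (λ (a , b) → b , a) (λ _ → refl))
             (▸-cong (missing? (N v) H ×-dec ¬? (v ∈? H)) (¬? (v ∈? H) ×-dec missing? (N v) H)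
               (λ (a , b) → b , a) (λ (a , b) → b , a) (λ _ → refl)))) ⟩
      ∑ₛ (λ H → ((v ∈? H ×-dec missing? (N v) H) ▸ 1) + ((¬? (v ∈? H) ×-dec missing? (N v) H) ▸ 1))
        ≡⟨ ∑-+ (subsets n) _ _ ⟩
      #missing-at v (N v) + ∑ₛ (λ H → (¬? (v ∈? H) ×-dec missing? (N v) H) ▸ 1)
        ≤⟨ +-monoʳ-≤ (#missing-at v (N v)) (∑-mono (subsets n) (λ H →
             ▸-mono (¬? (v ∈? H) ×-dec missing? (N v) H) (¬? (v ∈? H) ×-dec missing? (N v) (H ∪ ⁅ v ⁆))
               (λ (v∉H , H⊆N , H∉G) → v∉H , (λ {x} i → ∪-least H⊆N (⁅⁆⊆ (v∈N v)) {x} i) ,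
                 λ t → H∉G (down (p⊆p∪q ⁅ v ⁆) t)) (λ _ → ≤-refl))) ⟩
      #missing-at v (N v) + ∑ₛ (λ H → (¬? (v ∈? H) ×-dec missing? (N v) (H ∪ ⁅ v ⁆)) ▸ 1)
        ≡⟨ cong (#missing-at v (N v) +_) (trans
             (∑-cong (subsets n) (λ H → sym (▸-× (¬? (v ∈? H)) (missing? (N v) (H ∪ ⁅ v ⁆)))))
             (trans (sym (∑-link v (λ H → missing? (N v) H ▸ 1)))
               (∑-cong (subsets n) (λ H → ▸-× (v ∈? H) (missing? (N v) H))))) ⟩
      #missing-at v (N v) + #missing-at v (N v)
        ≤⟨ +-mono-≤ missing-at≤e missing-at≤e ⟩
      e + e
        ≡⟨ cong (e +_) (+-identityʳ e) ⟨
      2 * e ∎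
      where open ≤-Reasoning

    absent≤ : absent ≤ 2 * e * (e * p)
    absent≤ = begin
      absent
        ≤⟨ ∑-mono (subsets n) (λ H → ▸-mono (y ∈? H ×-dec missing? (N v) H) (missing? (N v) H) proj₂
             (λ (_ , m) → *-mono-≤ (≤-trans (∸-monoʳ-≤ d (d∸e≤ m)) (≤-reflexive (m∸[m∸n]≡n e≤d))) (q≤p m))) ⟩
      ∑ₛ (λ H → missing? (N v) H ▸ (e * p))
        ≡⟨ ∑-const-▸ (subsets n) (missing? (N v)) (e * p) ⟩
      e * p * #missing (N v)
        ≤⟨ *-monoʳ-≤ (e * p) #missing≤2e ⟩
      e * p * (2 * e)
        ≡⟨ *-comm (e * p) (2 * e) ⟩
      2 * e * (e * p) ∎
      where open ≤-Reasoning

    within+absent : κ * 2 ^ k + (within + absent) ≡ τ + κ * e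
    within+absent = begin
      κ * 2 ^ k + (within + absent)
        ≡⟨ cong₂ _+_ (trans (*-comm κ (2 ^ k)) (sym (cube-1 k κ))) (star-split y (N v) excess y∈N (∣N∣≡d small)) ⟩
      cube k (λ _ → κ) + cube k (excess ∘ suc)
        ≡⟨ cube-+ k (λ _ → κ) (excess ∘ suc) ⟨
      cube k (λ j → κ + excess (suc j))
        ≡⟨ cube-cong≤ k (λ j j≤k → q-split (suc j) (s≤s z≤n) (s≤s j≤k)) ⟨
      cube k (λ j → d * q (suc j))
        ≡⟨ trans (cube-*ˡ k d (q ∘ suc)) d*cube ⟩
      τ + κ * e ∎
      where open ≡-Reasoning

    -- The surplus is proportional to `r`, while the charges have a part independent of `r`; so
    -- `r = 1` is the worst case, and it is `near-bound`.
    charges≤ : (k + r) * (e * p) + 2 * e * (e * p) ≤ r * excess 2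
    charges≤ with r | 1≤r
    ... | suc r′ | _ = begin
      (k + suc r′) * (e * p) + 2 * e * (e * p)   ≡⟨ *-distribʳ-+ (e * p) (k + suc r′) (2 * e) ⟨
      (k + suc r′ + 2 * e) * (e * p)             ≤⟨ *-monoˡ-≤ (e * p) {k + suc r′ + 2 * e} {suc r′ * (d + 2 * e)} (≤-trans (m≤m+n _ (r′ * (k + 2 * e)))
                                                      (≤-reflexive (lemma k r′ e))) ⟩
      suc r′ * (d + 2 * e) * (e * p)             ≡⟨ *-assoc (suc r′) (d + 2 * e) (e * p) ⟩
      suc r′ * ((d + 2 * e) * (e * p))           ≤⟨ *-monoʳ-≤ (suc r′) near-bound ⟩
      suc r′ * excess 2                          ∎
      where
      open ≤-Reasoning
      lemma : ∀ k r e → k + suc r + 2 * e + r * (k + 2 * e) ≡ suc r * (suc k + 2 * e)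
      lemma = solve-∀

    -- Each set through `y` contributes `κ` and its excess. The `κ` parts depend on the degree
    -- alone, so `min-degree` handles them; for the excess, the nearly complete cube in `N v` is
    -- compared with the full one, and the pairs leaving `N v` come on top.
    balance : τ + outgoing y ≤ weight y
    balance = +-cancelʳ-≤ (κ * e + 2 * e * (e * p)) _ _ (begin
      τ + outgoing y + (κ * e + 2 * e * (e * p))
        ≤⟨ +-monoˡ-≤ _ (+-monoʳ-≤ τ outgoing≤) ⟩
      τ + (k + r) * (e * p) + (κ * e + 2 * e * (e * p))
        ≡⟨ lemma₁ τ ((k + r) * (e * p)) (κ * e) _ ⟩
      τ + κ * e + ((k + r) * (e * p) + 2 * e * (e * p))
        ≤⟨ +-monoʳ-≤ (τ + κ * e) (≤-trans charges≤ r*excess≤without) ⟩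
      τ + κ * e + without
        ≡⟨ cong (_+ without) within+absent ⟨
      κ * 2 ^ k + (within + absent) + without
        ≤⟨ +-monoˡ-≤ without (+-mono-≤ (*-monoʳ-≤ κ (min-degree y)) (+-monoʳ-≤ within absent≤)) ⟩
      κ * (degree G y + e) + (within + 2 * e * (e * p)) + without
        ≡⟨ lemma₂ κ (degree G y) e within (2 * e * (e * p)) without ⟩
      κ * degree G y + (within + without) + (κ * e + 2 * e * (e * p))
        ≡⟨ cong (_+ (κ * e + 2 * e * (e * p))) weight≡ ⟨
      weight y + (κ * e + 2 * e * (e * p)) ∎)
      where
      open ≤-Reasoning
      lemma₁ : ∀ a b c x → a + b + (c + x) ≡ a + c + (b + x)
      lemma₁ = solve-∀
      lemma₂ : ∀ x g e a b c → x * (g + e) + (a + b) + c ≡ x * g + (a + c) + (x * e + b)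
      lemma₂ = solve-∀

  -- Lowering the rank weight q 2 to q 3 keeps it antitone, and the difference δ is regained once for
  -- each of the at least k + 1 neighbours, but only k times in the cube of dimension k.
  module Far {y : Fin n} (big : ¬ Small y) (far : ∀ v → Small v → y ∉ N v) where

    outgoing≤0 : outgoing y ≤ 0
    outgoing≤0 = ≤-trans (∑-mono (vertices n) (λ u → ▸-≤ (small? u ×-dec y ∈? N u)
      λ (smallᵤ , y∈N) → contradiction y∈N (far u smallᵤ))) (≤-reflexive (∑-zero (vertices n)))

    link? : ∀ A → Dec (y ∉ A × T (G (A ∪ ⁅ y ⁆)))
    link? A = ¬? (y ∈? A) ×-dec T? (G (A ∪ ⁅ y ⁆))

    X : Family n
    X A = does (link? A)

    X-down : DownClosed X
    X-down {A} {B} A⊆B t = let y∉B , B∈G = T-does (link? B) t in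
      does-T (link? A) (y∉B ∘ A⊆B , down (λ i → ∪-least (p⊆p∪q ⁅ y ⁆ ∘ A⊆B) (q⊆p∪q B ⁅ y ⁆) i) B∈G)

    ∑-X : ∀ (h : ℕ → ℕ) → ∑ₛ (λ A → T? (X A) ▸ h (suc ∣ A ∣)) ≡ ∑ₛ (λ H → (y ∈? H ×-dec T? (G H)) ▸ h ∣ H ∣)
    ∑-X h = begin
      ∑ₛ (λ A → link? A ▸ h (suc ∣ A ∣))
        ≡⟨ ∑-cong (subsets n) (λ A → trans
             (▸-cong (link? A) (link? A) (λ m → m) (λ m → m) (λ (y∉A , _) → cong h (sym (∣p∪⁅v⁆∣ y A y∉A))))
             (sym (▸-× (¬? (y ∈? A)) (T? (G (A ∪ ⁅ y ⁆)))))) ⟩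
      ∑ₛ (λ A → ¬? (y ∈? A) ▸ T? (G (A ∪ ⁅ y ⁆)) ▸ h ∣ A ∪ ⁅ y ⁆ ∣)
        ≡⟨ ∑-link y (λ H → T? (G H) ▸ h ∣ H ∣) ⟨
      ∑ₛ (λ H → (y ∈? H) ▸ T? (G H) ▸ h ∣ H ∣)
        ≡⟨ ∑-cong (subsets n) (λ H → ▸-× (y ∈? H) (T? (G H))) ⟩
      ∑ₛ (λ H → (y ∈? H ×-dec T? (G H)) ▸ h ∣ H ∣) ∎
      where open ≡-Reasoning

    g : ℕ → ℕ
    g 1 = q 3
    g j = q (suc j)

    g-antitone : Antitone g
    g-antitone {0} {0} _ = ≤-refl
    g-antitone {0} {1} _ = q-antitone (s≤s z≤n)
    g-antitone {0} {suc (suc j)} _ = q-antitone (s≤s z≤n)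
    g-antitone {1} {1} _ = ≤-refl
    g-antitone {1} {suc (suc j)} _ = q-antitone (s≤s (s≤s (s≤s z≤n)))
    g-antitone {suc (suc i)} {1} (s≤s ())
    g-antitone {suc (suc i)} {suc (suc j)} i≤j = q-antitone (s≤s i≤j)

    q≡g : ∀ j → q (suc j) ≡ g j + δ * indicator₁ j
    q≡g 0 = sym (trans (cong (q 1 +_) (*-zeroʳ δ)) (+-identityʳ _))
    q≡g 1 = trans q2≡ (cong (q 3 +_) (sym (*-identityʳ δ)))
    q≡g (suc (suc j)) = sym (trans (cong (q (3 + j) +_) (*-zeroʳ δ)) (+-identityʳ _))

    singles : ℕ
    singles = ∑ₛ (λ A → T? (X A) ▸ indicator₁ ∣ A ∣)

    d≤singles : d ≤ singles
    d≤singles = begin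
      d
        ≤⟨ ∸-monoˡ-≤ 1 (≰⇒> big) ⟩
      ∣ N y ∣ ∸ 1
        ≡⟨ trans (∑-diff ⁅ y ⁆ (N y) (⁅⁆⊆ (v∈N y))) (cong (∣ N y ∣ ∸_) (∣⁅x⁆∣≡1 y)) ⟨
      ∑ᵥ (λ u → (u ∈? N y ×-dec ¬? (u ∈? ⁅ y ⁆)) ▸ 1)
        ≤⟨ ∑-witness (λ u → u ∈? N y ×-dec ¬? (u ∈? ⁅ y ⁆)) (λ A → link? A ×-dec (∣ A ∣ ≟ 1)) (λ A u → u ∈? A) 1
             (λ u (u∈N , u∉y) → ⁅ u ⁆ ,
               (((λ y∈u → u∉y (subst (_∈ ⁅ y ⁆) (x∈⁅y⁆⇒x≡y u y∈u) (x∈⁅x⁆ y))) ,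
                 subst (T ∘ G) (∪-comm ⁅ y ⁆ ⁅ u ⁆) (∈N⁻ u∈N)) , ∣⁅x⁆∣≡1 u) , x∈⁅x⁆ u) ⟩
      ∑ₛ (λ A → (link? A ×-dec (∣ A ∣ ≟ 1)) ▸ ∑ᵥ (λ u → (u ∈? A) ▸ 1))
        ≤⟨ ∑-mono (subsets n) (λ A → ▸-mono (link? A ×-dec (∣ A ∣ ≟ 1)) (T? (X A))
             (λ (l , _) → does-T (link? A) l)
             (λ (_ , eq) → ≤-reflexive (trans (sym (∣p∣≡∑ A)) (trans eq (cong indicator₁ (sym eq)))))) ⟩
      singles ∎
      where open ≤-Reasoning

    weight≡ : weight y ≡ d * (∑ₛ (λ A → T? (X A) ▸ g ∣ A ∣) + δ * singles)
    weight≡ = begin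
      weight y
        ≡⟨ ∑-X (λ s → d * q s) ⟨
      ∑ₛ (λ A → T? (X A) ▸ (d * q (suc ∣ A ∣)))
        ≡⟨ ∑-cong (subsets n) (λ A → trans (cong (T? (X A) ▸_) (cong (d *_) (q≡g ∣ A ∣)))
             (trans (sym (▸-*ˡ (T? (X A)) d)) (cong (d *_) (trans (▸-+ (T? (X A)))
               (cong ((T? (X A) ▸ g ∣ A ∣) +_) (sym (▸-*ˡ (T? (X A)) δ))))))) ⟩
      ∑ₛ (λ A → d * ((T? (X A) ▸ g ∣ A ∣) + δ * (T? (X A) ▸ indicator₁ ∣ A ∣)))
        ≡⟨ ∑-*ˡ (subsets n) d _ ⟩
      d * ∑ₛ (λ A → (T? (X A) ▸ g ∣ A ∣) + δ * (T? (X A) ▸ indicator₁ ∣ A ∣))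
        ≡⟨ cong (d *_) (trans (∑-+ (subsets n) _ _)
             (cong (∑ₛ (λ A → T? (X A) ▸ g ∣ A ∣) +_) (∑-*ˡ (subsets n) δ _))) ⟩
      d * (∑ₛ (λ A → T? (X A) ▸ g ∣ A ∣) + δ * singles) ∎
      where open ≡-Reasoning

    cube≡ : cube k (q ∘ suc) ≡ cube k g + δ * k
    cube≡ = trans (cube-cong k q≡g) (trans (cube-+ k g (λ j → δ * indicator₁ j))
      (cong (cube k g +_) (trans (cube-*ˡ k δ indicator₁) (cong (δ *_) (cube-indicator₁ k)))))

    -- Since `2 ≤ k - e`, the lowered value of `g` at 1 is not met, and the loss per absent set is
    -- the same `p` as for small vertices.
    g[k∸e]≡p : g (k ∸ e) ≡ p
    g[k∸e]≡p = trans (g≡q (k ∸ e) (m+n≤o⇒m≤o∸n 2 2+e≤k)) (cong q (sym (+-∸-assoc 1 e≤k)))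
      where
      g≡q : ∀ j → 2 ≤ j → g j ≡ q (suc j)
      g≡q (suc (suc j)) _ = refl
      g≡q (suc zero) (s≤s ())

    cube≤ : cube k g ≤ ∑ₛ (λ A → T? (X A) ▸ g ∣ A ∣) + e * p
    cube≤ = begin
      cube k g
        ≤⟨ cube≤initial g-antitone n k k≤n (2 ^ k ∸ e) e (m∸n+n≡m (<⇒≤ e<2^k)) ⟩
      initial n g (2 ^ k ∸ e) + e * g (k ∸ e)
        ≤⟨ +-mono-≤ (initial-mono n g count≥) (≤-reflexive (cong (e *_) g[k∸e]≡p)) ⟩
      initial n g (count X) + e * p
        ≤⟨ +-monoˡ-≤ (e * p) (katona n g-antitone X X-down) ⟩
      ∑ₛ (λ A → T? (X A) ▸ g ∣ A ∣) + e * p ∎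
      where
      open ≤-Reasoning
      k≤n : k ≤ n
      k≤n = ≤-trans (n≤1+n k) (≤-trans (d≤∣N∣ y) (∣p∣≤n (N y)))
      count≥ : 2 ^ k ∸ e ≤ count X
      count≥ = ≤-trans (∸-monoˡ-≤ e (min-degree y)) (≤-reflexive (trans (m+n∸n≡m (degree G y) e) (sym (∑-X (λ _ → 1)))))

    -- Falling `e` sets short of a cube costs at most `e * (d * p) = κ * e + e * (e * p)`. The first
    -- part is the margin of the target; the second is covered by the extra singleton of the link,
    -- worth `d * δ`.
    balance : τ + outgoing y ≤ weight y
    balance = +-cancelʳ-≤ (κ * e + d * δ) _ _ (begin
      τ + outgoing y + (κ * e + d * δ)
        ≤⟨ +-monoˡ-≤ (κ * e + d * δ) (+-monoʳ-≤ τ outgoing≤0) ⟩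
      τ + 0 + (κ * e + d * δ)
        ≡⟨ lemma₁ τ (κ * e) (d * δ) ⟩
      τ + κ * e + d * δ
        ≡⟨ cong (_+ d * δ) d*cube ⟨
      d * cube k (q ∘ suc) + d * δ
        ≡⟨ cong (λ x → d * x + d * δ) cube≡ ⟩
      d * (cube k g + δ * k) + d * δ
        ≡⟨ lemma₂ k (cube k g) δ ⟩
      d * (cube k g + δ * d)
        ≤⟨ *-monoʳ-≤ d (+-mono-≤ cube≤ (*-monoʳ-≤ δ d≤singles)) ⟩
      d * (∑ₛ (λ A → T? (X A) ▸ g ∣ A ∣) + e * p + δ * singles)
        ≡⟨ lemma₃ d (∑ₛ (λ A → T? (X A) ▸ g ∣ A ∣)) e p (δ * singles) ⟩
      d * (∑ₛ (λ A → T? (X A) ▸ g ∣ A ∣) + δ * singles) + e * (d * p)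
        ≡⟨ cong₂ _+_ (sym weight≡) (trans (cong (e *_) d*p) (*-distribˡ-+ e κ (e * p))) ⟩
      weight y + (e * κ + e * (e * p))
        ≤⟨ +-monoʳ-≤ (weight y) (+-mono-≤ (≤-reflexive (*-comm e κ)) far-bound) ⟩
      weight y + (κ * e + d * δ) ∎)
      where
      open ≤-Reasoning
      lemma₁ : ∀ a b c → a + 0 + (b + c) ≡ a + b + c
      lemma₁ = solve-∀
      lemma₂ : ∀ k c x → suc k * (c + x * k) + suc k * x ≡ suc k * (c + x * suc k)
      lemma₂ = solve-∀
      lemma₃ : ∀ d a e p s → d * (a + e * p + s) ≡ d * (a + s) + e * (d * p)
      lemma₃ = solve-∀

  -- Summation over all vertices

  balance : ∀ v → τ + outgoing v ≤ weight v + incoming v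
  balance v with small? v
  ... | yes small = [ SmallVertex.Light.balance small , Heavy.balance small ]′ (toSum (#missing (N v) ≤? e))
  ... | no big with Fin.any? (λ u → small? u ×-dec v ∈? N u)
  ...   | yes (u , smallᵤ , v∈N) = ≤-trans (Near.balance smallᵤ big v∈N) (m≤m+n _ _)
  ...   | no far = ≤-trans (Far.balance big (λ u smallᵤ v∈N → far (u , smallᵤ , v∈N))) (m≤m+n _ _)

  n*τ≤∑weight : n * τ ≤ ∑ᵥ weight
  n*τ≤∑weight = +-cancelʳ-≤ (∑ᵥ outgoing) _ _ (begin
    n * τ + ∑ᵥ outgoing                ≡⟨ cong (_+ ∑ᵥ outgoing) (∑-const n τ) ⟨
    ∑ᵥ {n} (λ _ → τ) + ∑ᵥ outgoing     ≡⟨ ∑-+ (vertices n) (λ _ → τ) outgoing ⟨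
    ∑ᵥ (λ v → τ + outgoing v)          ≤⟨ ∑-mono (vertices n) balance ⟩
    ∑ᵥ (λ v → weight v + incoming v)   ≡⟨ ∑-+ (vertices n) weight incoming ⟩
    ∑ᵥ weight + ∑ᵥ incoming            ≡⟨ cong (∑ᵥ weight +_) (∑-swap (vertices n) (vertices n) (λ v u → pay u v)) ⟩
    ∑ᵥ weight + ∑ᵥ outgoing            ∎)
    where open ≤-Reasoning

  ∑weight≡ : ∑ᵥ weight ≡ ∑ₛ (λ H → T? (G H) ▸ (d * q ∣ H ∣ * ∣ H ∣))
  ∑weight≡ = begin
    ∑ᵥ weight
      ≡⟨ ∑-swap (vertices n) (subsets n) (λ v H → (v ∈? H ×-dec T? (G H)) ▸ (d * q ∣ H ∣)) ⟩
    ∑ₛ (λ H → ∑ᵥ (λ v → (v ∈? H ×-dec T? (G H)) ▸ (d * q ∣ H ∣)))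
      ≡⟨ ∑-cong (subsets n) (λ H → trans
           (∑-cong (vertices n) (λ v → trans (sym (▸-× (v ∈? H) (T? (G H)))) (▸-comm (v ∈? H) (T? (G H)))))
           (trans (∑-▸ (vertices n) (T? (G H)) _) (cong (T? (G H) ▸_)
             (trans (∑-const-▸ (vertices n) (_∈? H) (d * q ∣ H ∣)) (cong (d * q ∣ H ∣ *_) (sym (∣p∣≡∑ H))))))) ⟩
    ∑ₛ (λ H → T? (G H) ▸ (d * q ∣ H ∣ * ∣ H ∣)) ∎
    where open ≡-Reasoning

  -- The empty set gives its weight to no vertex. Counting it separately produces the summand `d`,
  -- so the number of members strictly exceeds `n * (2 ^ d - c) / d`.
  bound : T (G ⊥) → n * (2 ^ d ∸ suc e) + d ≤ d * count G
  bound ∅∈G = *-cancelˡ-≤ κ {{d !≢0}} (begin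
    κ * (n * (2 ^ d ∸ suc e) + d)
      ≡⟨ lemma κ n (2 ^ d ∸ suc e) d ⟩
    n * τ + d * κ
      ≤⟨ +-mono-≤ (≤-trans n*τ≤∑weight (≤-reflexive ∑weight≡)) empty ⟩
    ∑ₛ (λ H → T? (G H) ▸ (d * q ∣ H ∣ * ∣ H ∣)) + ∑ₛ (λ H → T? (G H) ▸ (∣ H ∣ ≟ 0) ▸ (d * κ))
      ≡⟨ ∑-+ (subsets n) _ _ ⟨
    ∑ₛ (λ H → (T? (G H) ▸ (d * q ∣ H ∣ * ∣ H ∣)) + (T? (G H) ▸ (∣ H ∣ ≟ 0) ▸ (d * κ)))
      ≤⟨ ∑-mono (subsets n) (λ H → ≤-trans (≤-reflexive (sym (▸-+ (T? (G H)))))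
           (▸-mono (T? (G H)) (T? (G H)) (λ t → t) (λ t → share ∣ H ∣ (bounded H t)))) ⟩
    ∑ₛ (λ H → T? (G H) ▸ (d * κ))
      ≡⟨ ∑-const-▸ (subsets n) (λ H → T? (G H)) (d * κ) ⟩
    d * κ * count G
      ≡⟨ trans (cong (_* count G) (*-comm d κ)) (*-assoc κ d _) ⟩
    κ * (d * count G) ∎)
    where
    open ≤-Reasoning
    lemma : ∀ x n t d → x * (n * t + d) ≡ n * (x * t) + d * x
    lemma = solve-∀
    empty : d * κ ≤ ∑ₛ (λ H → T? (G H) ▸ (∣ H ∣ ≟ 0) ▸ (d * κ))
    empty = ≤-trans
      (≤-reflexive (sym (trans (▸-yes (T? (G (⊥ {n}))) ∅∈G) (▸-yes (∣ ⊥ {n} ∣ ≟ 0) (∣⊥∣≡0 n)))))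
      (∑-∈ (λ H → T? (G H) ▸ (∣ H ∣ ≟ 0) ▸ (d * κ)) (∈-subsets (⊥ {n})))
    share : ∀ s → s ≤ d → d * q s * s + ((s ≟ 0) ▸ (d * κ)) ≤ d * κ
    share zero s≤d = ≤-reflexive (cong (_+ d * κ) (*-zeroʳ (d * q 0)))
    share (suc s) s≤d = ≤-reflexive (trans (+-identityʳ _) (trans (*-assoc d (q (suc s)) (suc s))
      (cong (d *_) (trans (*-comm (q (suc s)) (suc s)) (q-exact (suc s) (s≤s z≤n) s≤d)))))

-- Discarding large sets

shrink₀ : (m : ℕ) (H : Subset n) → m ≤ ∣ H ∣ → ∃ λ K → K ⊆ H × ∣ K ∣ ≡ m
shrink₀ {n} zero H m≤H = ⊥ , ⊥⊆ , ∣⊥∣≡0 n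
shrink₀ (suc m) (outside ∷ H) m≤H = let K , K⊆H , eq = shrink₀ (suc m) H m≤H in outside ∷ K , s⊆s K⊆H , eq
shrink₀ (suc m) (inside ∷ H) (s≤s m≤H) = let K , K⊆H , eq = shrink₀ m H m≤H in inside ∷ K , s⊆s K⊆H , cong suc eq

shrink : (m : ℕ) (v : Fin n) (H : Subset n) → v ∈ H → suc m ≤ ∣ H ∣ → ∃ λ K → v ∈ K × K ⊆ H × ∣ K ∣ ≡ suc m
shrink m zero (inside ∷ H) here (s≤s m≤H) =
  let K , K⊆H , eq = shrink₀ m H m≤H in inside ∷ K , here , s⊆s K⊆H , cong suc eq
shrink m (suc v) (outside ∷ H) (there v∈H) m≤H =
  let K , v∈K , K⊆H , eq = shrink m v H v∈H m≤H in outside ∷ K , there v∈K , s⊆s K⊆H , eq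
shrink m (suc v) (inside ∷ H) (there v∈H) (s≤s m≤H) with suc m ≤? ∣ H ∣
... | yes m<H = let K , v∈K , K⊆H , eq = shrink m v H v∈H m<H in outside ∷ K , there v∈K , out⊆ K⊆H , eq
... | no m≮H = inside ∷ H , there v∈H , ⊆-refl , cong suc (≤-antisym (s≤s⁻¹ (≰⇒> m≮H)) m≤H)

-- Sets with more than k + 1 elements may be discarded: the (k + 1)-subsets through v of such a set
-- already give v degree 2 ^ k.
module Truncation {k e : ℕ} (G : Family n) (down : DownClosed G)
  (min-degree : ∀ v → 2 ^ k ≤ degree G v + e) where

  truncated? : ∀ H → Dec (T (G H) × ∣ H ∣ ≤ suc k)
  truncated? H = T? (G H) ×-dec (∣ H ∣ ≤? suc k)

  truncated : Family n
  truncated H = does (truncated? H)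

  truncated-down : DownClosed truncated
  truncated-down {A} {B} A⊆B t = let B∈G , small = T-does (truncated? B) t in
    does-T (truncated? A) (down A⊆B B∈G , ≤-trans (p⊆q⇒∣p∣≤∣q∣ A⊆B) small)

  truncated-bounded : ∀ H → T (truncated H) → ∣ H ∣ ≤ suc k
  truncated-bounded H t = proj₂ (T-does (truncated? H) t)

  truncated-degree : ∀ v → 2 ^ k ≤ degree truncated v + e
  truncated-degree v with anySubset? (λ H → (v ∈? H ×-dec T? (G H)) ×-dec (suc k <? ∣ H ∣))
  ... | yes (H , (v∈H , H∈G) , large) = let K , v∈K , K⊆H , eq = shrink k v H v∈H (<⇒≤ large) in begin
    2 ^ k
      ≡⟨ trans (cube-1 k 1) (*-identityʳ (2 ^ k)) ⟨
    cube k (λ _ → 1)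
      ≡⟨ star v K k (λ _ → 1) v∈K eq ⟨
    ∑ₛ (λ X → (v ∈? X ×-dec X ⊆? K) ▸ 1)
      ≤⟨ ∑-mono (subsets n) (λ X → ▸-mono (v ∈? X ×-dec X ⊆? K) (v ∈? X ×-dec T? (truncated X))
           (λ (v∈X , X⊆K) → v∈X , does-T (truncated? X) (down (K⊆H ∘ X⊆K) H∈G ,
             ≤-trans (p⊆q⇒∣p∣≤∣q∣ X⊆K) (≤-reflexive eq))) (λ _ → ≤-refl)) ⟩
    degree truncated v
      ≤⟨ m≤m+n _ e ⟩
    degree truncated v + e ∎
    where open ≤-Reasoning
  ... | no all-small = ≤-trans (min-degree v) (+-monoˡ-≤ e (∑-mono (subsets n) (λ H →
    ▸-mono (v ∈? H ×-dec T? (G H)) (v ∈? H ×-dec T? (truncated H))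
      (λ (v∈H , H∈G) → v∈H , does-T (truncated? H) (H∈G , ≮⇒≥ (λ large → all-small (H , (v∈H , H∈G) , large))))
      (λ _ → ≤-refl))))

  truncated-count : count truncated ≤ count G
  truncated-count = ∑-mono (subsets n) (λ H →
    ▸-mono (T? (truncated H)) (T? (G H)) (proj₁ ∘ T-does (truncated? H)) (λ _ → ≤-refl))

size-bound : ∀ {k e} → 4 * suc e ≤ suc k → (G : Family n) → DownClosed G → T (G ⊥) →
  (∀ v → 2 ^ k ≤ degree G v + e) → n * (2 ^ suc k ∸ suc e) + suc k ≤ suc k * count G
size-bound {n} {k} {e} 4c≤d G down ∅∈G min-degree =
  ≤-trans
    (Discharging.bound 4c≤d truncated (λ {A} {B} → truncated-down {A} {B}) truncated-bounded truncated-degree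
      (does-T (truncated? ⊥) (∅∈G , ≤-trans (≤-reflexive (∣⊥∣≡0 n)) z≤n)))
    (*-monoʳ-≤ (suc k) truncated-count)
  where open Truncation {k = k} {e} G (λ {A} {B} → down {A} {B}) min-degree

-- Loss at a vertex and down-compression

-- The number of members that F loses when v is deleted.
loss : Fin n → Family n → ℕ
loss zero F = count (λ A → F (outside ∷ A) ∧ F (inside ∷ A))
loss (suc v) F = loss v (F ∘ (outside ∷_)) + loss v (F ∘ (inside ∷_))

_⊆ᶠ_ : Family n → Family n → Set
F ⊆ᶠ F′ = ∀ A → T (F A) → T (F′ A)

∧⁺ : ∀ a b → T a → T b → T (a ∧ b)
∧⁺ true true _ _ = tt

∧⁻ : ∀ a b → T (a ∧ b) → T a × T b
∧⁻ true true _ = tt , tt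

count-mono : {F F′ : Family n} → F ⊆ᶠ F′ → count F ≤ count F′
count-mono {n} {F} {F′} sub = ∑-mono (subsets n) (λ A → ▸-mono (T? (F A)) (T? (F′ A)) (sub A) (λ _ → ≤-refl))

count-∷ : (F : Family (suc n)) → count F ≡ count (F ∘ (outside ∷_)) + count (F ∘ (inside ∷_))
count-∷ F = ∑ₛ-∷ (λ A → T? (F A) ▸ 1)

loss-mono : (v : Fin n) {F F′ : Family n} → F ⊆ᶠ F′ → loss v F ≤ loss v F′
loss-mono zero {F} {F′} sub = count-mono (λ A t → let a , b = ∧⁻ (F (outside ∷ A)) (F (inside ∷ A)) t in
  ∧⁺ (F′ (outside ∷ A)) (F′ (inside ∷ A)) (sub _ a) (sub _ b))
loss-mono (suc v) sub = +-mono-≤ (loss-mono v (sub ∘ (outside ∷_))) (loss-mono v (sub ∘ (inside ∷_)))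

loss-down : (v : Fin n) (G : Family n) → DownClosed G → loss v G ≡ degree G v
loss-down {suc n} zero G down = begin
  count (λ A → G (outside ∷ A) ∧ G (inside ∷ A))
    ≡⟨ ∑-cong (subsets n) (λ A → ▸-cong (T? (G (outside ∷ A) ∧ G (inside ∷ A))) (T? (G (inside ∷ A)))
         (proj₂ ∘ ∧⁻ (G (outside ∷ A)) (G (inside ∷ A)))
         (λ t → ∧⁺ (G (outside ∷ A)) (G (inside ∷ A)) (down (out⊆ ⊆-refl) t) t) (λ _ → refl)) ⟩
  ∑ₛ (λ A → T? (G (inside ∷ A)) ▸ 1)
    ≡⟨ cong (_+ ∑ₛ (λ A → T? (G (inside ∷ A)) ▸ 1)) (∑-zero (subsets n)) ⟨
  ∑ₛ {n} (λ _ → 0) + ∑ₛ (λ A → T? (G (inside ∷ A)) ▸ 1)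
    ≡⟨ ∑ₛ-∷ (λ H → (zero ∈? H ×-dec T? (G H)) ▸ 1) ⟨
  degree G zero ∎
  where open ≡-Reasoning
loss-down (suc v) G down = trans
  (cong₂ _+_ (loss-down v (G ∘ (outside ∷_)) (down ∘ s⊆s)) (loss-down v (G ∘ (inside ∷_)) (down ∘ s⊆s)))
  (sym (∑ₛ-∷ (λ H → (suc v ∈? H ×-dec T? (G H)) ▸ 1)))

_∪ᶠ_ _∩ᶠ_ : Family n → Family n → Family n
(F ∪ᶠ F′) A = F A ∨ F′ A
(F ∩ᶠ F′) A = F A ∧ F′ A

count-∪-∩ : (F F′ : Family n) → count (F ∪ᶠ F′) + count (F ∩ᶠ F′) ≡ count F + count F′
count-∪-∩ {n} F F′ = trans (sym (∑-+ (subsets n) _ _))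
  (trans (∑-cong (subsets n) (λ A → pointwise (F A) (F′ A))) (∑-+ (subsets n) _ _))
  where
  pointwise : ∀ a b → (T? (a ∨ b) ▸ 1) + (T? (a ∧ b) ▸ 1) ≡ (T? a ▸ 1) + (T? b ▸ 1)
  pointwise true true = refl
  pointwise true false = refl
  pointwise false true = refl
  pointwise false false = refl

-- Loss counts the pairs `A`, `A ∪ ⁅ v ⁆` inside the family. A pair inside `F` or `F′` lies inside
-- the union, and a pair inside both also lies inside the intersection.
loss-∪-∩ : (v : Fin n) (F F′ : Family n) → loss v F + loss v F′ ≤ loss v (F ∪ᶠ F′) + loss v (F ∩ᶠ F′)
loss-∪-∩ {suc n} zero F F′ = begin
  loss zero F + loss zero F′
    ≡⟨ ∑-+ (subsets n) _ _ ⟨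
  ∑ₛ (λ A → (T? (F (outside ∷ A) ∧ F (inside ∷ A)) ▸ 1) + (T? (F′ (outside ∷ A) ∧ F′ (inside ∷ A)) ▸ 1))
    ≤⟨ ∑-mono (subsets n) (λ A → pointwise (F (outside ∷ A)) (F (inside ∷ A)) (F′ (outside ∷ A)) (F′ (inside ∷ A))) ⟩
  ∑ₛ (λ A → (T? ((F ∪ᶠ F′) (outside ∷ A) ∧ (F ∪ᶠ F′) (inside ∷ A)) ▸ 1)
    + (T? ((F ∩ᶠ F′) (outside ∷ A) ∧ (F ∩ᶠ F′) (inside ∷ A)) ▸ 1))
    ≡⟨ ∑-+ (subsets n) _ _ ⟩
  loss zero (F ∪ᶠ F′) + loss zero (F ∩ᶠ F′) ∎
  where
  open ≤-Reasoning
  pointwise : ∀ a b c d → (T? (a ∧ b) ▸ 1) + (T? (c ∧ d) ▸ 1)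
    ≤ (T? ((a ∨ c) ∧ (b ∨ d)) ▸ 1) + (T? ((a ∧ c) ∧ (b ∧ d)) ▸ 1)
  pointwise true true true true = ≤-refl
  pointwise true true true false = ≤-refl
  pointwise true true false d = m≤m+n 1 _
  pointwise true false true true = ≤-refl
  pointwise true false true false = z≤n
  pointwise true false false d = z≤n
  pointwise false b true true with b
  ... | true = ≤-refl
  ... | false = ≤-refl
  pointwise false b true false = z≤n
  pointwise false b false d = z≤n
loss-∪-∩ (suc v) F F′ = begin
  loss v F₀ + loss v F₁ + (loss v F′₀ + loss v F′₁)
    ≡⟨ middle (loss v F₀) _ _ _ ⟩
  loss v F₀ + loss v F′₀ + (loss v F₁ + loss v F′₁)
    ≤⟨ +-mono-≤ (loss-∪-∩ v F₀ F′₀) (loss-∪-∩ v F₁ F′₁) ⟩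
  loss v (F₀ ∪ᶠ F′₀) + loss v (F₀ ∩ᶠ F′₀) + (loss v (F₁ ∪ᶠ F′₁) + loss v (F₁ ∩ᶠ F′₁))
    ≡⟨ middle (loss v (F₀ ∪ᶠ F′₀)) _ _ _ ⟩
  loss (suc v) (F ∪ᶠ F′) + loss (suc v) (F ∩ᶠ F′) ∎
  where
  open ≤-Reasoning
  F₀ = F ∘ (outside ∷_)
  F₁ = F ∘ (inside ∷_)
  F′₀ = F′ ∘ (outside ∷_)
  F′₁ = F′ ∘ (inside ∷_)

-- A single down-compression per coordinate suffices: compressing in a later coordinate keeps the
-- family closed downwards in the earlier ones.
compress : Family n → Family n
compress {zero} F [] = F []
compress {suc n} F (outside ∷ A) = compress ((F ∘ (outside ∷_)) ∪ᶠ (F ∘ (inside ∷_))) A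
compress {suc n} F (inside ∷ A) = compress ((F ∘ (outside ∷_)) ∩ᶠ (F ∘ (inside ∷_))) A

compress-mono : {F F′ : Family n} → F ⊆ᶠ F′ → compress F ⊆ᶠ compress F′
compress-mono {zero} sub [] t = sub [] t
compress-mono {suc n} {F} {F′} sub (outside ∷ A) t = compress-mono
  (λ B → ∨-map (F (outside ∷ B)) (F (inside ∷ B)) (F′ (outside ∷ B)) (F′ (inside ∷ B)) (sub _) (sub _)) A t
  where
  ∨-map : ∀ a b c d → (T a → T c) → (T b → T d) → T (a ∨ b) → T (c ∨ d)
  ∨-map a b true d f g t = tt
  ∨-map true b false d f g t = contradiction (f tt) λ ()
  ∨-map false true false d f g t = g t
compress-mono {suc n} {F} {F′} sub (inside ∷ A) t = compress-mono
  (λ B t → let a , b = ∧⁻ (F (outside ∷ B)) (F (inside ∷ B)) t in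
    ∧⁺ (F′ (outside ∷ B)) (F′ (inside ∷ B)) (sub _ a) (sub _ b)) A t

compress-down : (F : Family n) → DownClosed (compress F)
compress-down {zero} F {[]} {[]} A⊆B t = t
compress-down {suc n} F {outside ∷ A} {outside ∷ B} A⊆B t = compress-down _ (drop-∷-⊆ A⊆B) t
compress-down {suc n} F {outside ∷ A} {inside ∷ B} A⊆B t =
  compress-mono (λ C → ∧⇒∨ (F (outside ∷ C)) (F (inside ∷ C))) A (compress-down _ (drop-∷-⊆ A⊆B) t)
  where
  ∧⇒∨ : ∀ a b → T (a ∧ b) → T (a ∨ b)
  ∧⇒∨ true b _ = tt
compress-down {suc n} F {inside ∷ A} {outside ∷ B} A⊆B t = contradiction (A⊆B here) λ ()
compress-down {suc n} F {inside ∷ A} {inside ∷ B} A⊆B t = compress-down _ (drop-∷-⊆ A⊆B) t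

count-compress : (F : Family n) → count (compress F) ≡ count F
count-compress {zero} F = refl
count-compress {suc n} F = begin
  count (compress F)                           ≡⟨ count-∷ (compress F) ⟩
  count (compress (F₀ ∪ᶠ F₁)) + count (compress (F₀ ∩ᶠ F₁))
                                               ≡⟨ cong₂ _+_ (count-compress (F₀ ∪ᶠ F₁)) (count-compress (F₀ ∩ᶠ F₁)) ⟩
  count (F₀ ∪ᶠ F₁) + count (F₀ ∩ᶠ F₁)          ≡⟨ count-∪-∩ F₀ F₁ ⟩
  count F₀ + count F₁                          ≡⟨ count-∷ F ⟨
  count F                                      ∎
  where
  open ≡-Reasoning
  F₀ = F ∘ (outside ∷_)
  F₁ = F ∘ (inside ∷_)

-- For the first coordinate the loss is the size of the intersection of the slices, which
-- compression keeps. For later ones, replacing the slices by union and intersection does not lower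
-- the loss, by supermodularity.
loss-compress : (v : Fin n) (F : Family n) → loss v F ≤ loss v (compress F)
loss-compress zero F = begin
  count (F₀ ∩ᶠ F₁)                        ≡⟨ count-compress (F₀ ∩ᶠ F₁) ⟨
  count (compress (F₀ ∩ᶠ F₁))             ≤⟨ count-mono (λ A t → ∧⁺ (compress (F₀ ∪ᶠ F₁) A) (compress (F₀ ∩ᶠ F₁) A)
                                               (compress-down F {outside ∷ A} {inside ∷ A} (out⊆ ⊆-refl) t) t) ⟩
  loss zero (compress F)                  ∎
  where
  open ≤-Reasoning
  F₀ = F ∘ (outside ∷_)
  F₁ = F ∘ (inside ∷_)
loss-compress (suc v) F = ≤-trans (loss-∪-∩ v (F ∘ (outside ∷_)) (F ∘ (inside ∷_)))
  (+-mono-≤ (loss-compress v _) (loss-compress v _))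

-- Families given by lists, and their traces

∑ₛ-point : (A : Subset n) (f : Subset n → ℕ) → ∑ₛ (λ H → (H ≟ₛ A) ▸ f H) ≡ f A
∑ₛ-point {n} A f = begin
  ∑ₛ (λ H → (H ≟ₛ A) ▸ f H)
    ≡⟨ ∑-cong (subsets n) (λ H → ▸-cong (H ≟ₛ A) (A ⊆? H ×-dec H ⊆? A)
         (λ { refl → (λ i → i) , λ i → i }) (λ (a , b) → ⊆-antisym b a) (λ { refl → refl })) ⟩
  ∑ₛ (λ H → (A ⊆? H ×-dec H ⊆? A) ▸ f A)
    ≡⟨ ∑ₛ-interval A A 0 (λ _ → f A) ⊆-refl refl ⟩
  f A ∎
  where open ≡-Reasoning

module _ {n : ℕ} where
  open DecMembership (_≟ₛ_ {n}) using () renaming (_∈?_ to _∈ˡ?_)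

  family : List (Subset n) → Family n
  family l H = does (H ∈ˡ? l)

  length≡count : (l : List (Subset n)) → Unique l → length l ≡ count (family l)
  length≡count [] _ = sym (∑-zero (subsets n))
  length≡count (x ∷ l) (x∉l ∷ unique) = sym (begin
    ∑ₛ (λ H → (H ∈ˡ? (x ∷ l)) ▸ 1)
      ≡⟨ ∑-cong (subsets n) (λ H → trans (▸-split (H ∈ˡ? (x ∷ l)) (H ≟ₛ x)) (cong₂ _+_
           (▸-cong (H ∈ˡ? (x ∷ l) ×-dec H ≟ₛ x) (H ≟ₛ x) proj₂ (λ eq → here eq , eq) (λ _ → refl))
           (▸-cong (H ∈ˡ? (x ∷ l) ×-dec ¬? (H ≟ₛ x)) (H ∈ˡ? l)
             (λ { (here eq , ne) → contradiction eq ne ; (there i , _) → i })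
             (λ i → there i , λ { refl → All.lookup x∉l i refl }) (λ _ → refl)))) ⟩
    ∑ₛ (λ H → ((H ≟ₛ x) ▸ 1) + ((H ∈ˡ? l) ▸ 1))
      ≡⟨ ∑-+ (subsets n) _ _ ⟩
    ∑ₛ (λ H → (H ≟ₛ x) ▸ 1) + count (family l)
      ≡⟨ cong₂ _+_ (∑ₛ-point x (λ _ → 1)) (sym (length≡count l unique)) ⟩
    suc (length l) ∎)
    where open ≡-Reasoning

  length-deduplicate : (l : List (Subset n)) → length (deduplicate _≟ₛ_ l) ≡ count (family l)
  length-deduplicate l = trans (length≡count (deduplicate _≟ₛ_ l) (DecUnique.deduplicate-! _≟ₛ_ l))
    (∑-cong (subsets n) (λ H → ▸-cong (H ∈ˡ? deduplicate _≟ₛ_ l) (H ∈ˡ? l)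
      (∈-deduplicate⁻ _≟ₛ_ l) (∈-deduplicate⁺ _≟ₛ_) (λ _ → refl)))

  trace-take : ∀ m (l : List (Subset n)) X → length (trace (takeˡ m l) X) ≤ length (trace l X)
  trace-take m l X = begin
    length (trace (takeˡ m l) X)              ≡⟨ length-deduplicate (map (_∩ X) (takeˡ m l)) ⟩
    count (family (map (_∩ X) (takeˡ m l)))   ≤⟨ count-mono {F = family (map (_∩ X) (takeˡ m l))} {family (map (_∩ X) l)}
                                                   (λ A t → does-T (A ∈ˡ? map (_∩ X) l) (widen (T-does (A ∈ˡ? map (_∩ X) (takeˡ m l)) t))) ⟩
    count (family (map (_∩ X) l))             ≡⟨ length-deduplicate (map (_∩ X) l) ⟨
    length (trace l X)                        ∎
    where
    open ≤-Reasoning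
    widen : ∀ {A} → A ∈ˡ map (_∩ X) (takeˡ m l) → A ∈ˡ map (_∩ X) l
    widen i = let H , j , eq = ∈-map⁻ _ i in
      subst (_∈ˡ _) (sym eq) (∈-map⁺ _ (subst (H ∈ˡ_) (takeˡ++dropˡ≡id m l) (∈-++⁺ˡ j)))

  toList : Family n → List (Subset n)
  toList F = deduplicate _≟ₛ_ (filter (λ H → T? (F H)) (subsets n))

  toList-unique : ∀ F → Unique (toList F)
  toList-unique F = DecUnique.deduplicate-! _≟ₛ_ _

  ∈-toList⁺ : ∀ {F H} → T (F H) → H ∈ˡ toList F
  ∈-toList⁺ {F} {H} t = ∈-deduplicate⁺ _≟ₛ_ (∈-filter⁺ (λ H → T? (F H)) (∈-subsets H) t)

  ∈-toList⁻ : ∀ {F H} → H ∈ˡ toList F → T (F H)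
  ∈-toList⁻ {F} i = proj₂ (∈-filter⁻ (λ H → T? (F H)) {xs = subsets n} (∈-deduplicate⁻ _≟ₛ_ _ i))

  length-toList : ∀ F → length (toList F) ≡ count F
  length-toList F = trans (length≡count (toList F) (toList-unique F))
    (∑-cong (subsets n) (λ H → ▸-cong (H ∈ˡ? toList F) (T? (F H)) ∈-toList⁻ ∈-toList⁺ (λ _ → refl)))

  ⊆-toList : ∀ F → F ⊆ᶠ family (toList F)
  ⊆-toList F H t = does-T (H ∈ˡ? toList F) (∈-toList⁺ t)

-- Membership in the trace on the complement of `v`, whose members avoid `v` and come from `A` or
-- from `A ∪ ⁅ v ⁆`.
shadow? : (v : Fin n) (F : Family n) (A : Subset n) → Dec (v ∉ A × (T (F A) ⊎ T (F (A ∪ ⁅ v ⁆))))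
shadow? v F A = ¬? (v ∈? A) ×-dec (T? (F A) ⊎-dec T? (F (A ∪ ⁅ v ⁆)))

shadow+loss : (v : Fin n) (F : Family n) → ∑ₛ (λ A → shadow? v F A ▸ 1) + loss v F ≡ count F
shadow+loss {suc n} zero F = begin
  ∑ₛ (λ A → shadow? zero F A ▸ 1) + loss zero F
    ≡⟨ cong (_+ loss zero F) (∑ₛ-∷ (λ A → shadow? zero F A ▸ 1)) ⟩
  ∑ₛ (λ A → (T? (F (outside ∷ A)) ⊎-dec T? (F (inside ∷ (A ∪ ⊥)))) ▸ 1) + ∑ₛ {n} (λ _ → 0) + loss zero F
    ≡⟨ cong (_+ loss zero F) (trans (cong₂ _+_ (∑-cong (subsets n) (λ A →
         cong (λ B → (T? (F (outside ∷ A)) ⊎-dec T? (F (inside ∷ B))) ▸ 1) (∪-identityʳ A))) (∑-zero (subsets n)))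
         (+-identityʳ _)) ⟩
  count ((F ∘ (outside ∷_)) ∪ᶠ (F ∘ (inside ∷_))) + count ((F ∘ (outside ∷_)) ∩ᶠ (F ∘ (inside ∷_)))
    ≡⟨ count-∪-∩ (F ∘ (outside ∷_)) (F ∘ (inside ∷_)) ⟩
  count (F ∘ (outside ∷_)) + count (F ∘ (inside ∷_))
    ≡⟨ count-∷ F ⟨
  count F ∎
  where open ≡-Reasoning
shadow+loss {suc n} (suc v) F = begin
  ∑ₛ (λ A → shadow? (suc v) F A ▸ 1) + (loss v F₀ + loss v F₁)
    ≡⟨ cong (_+ (loss v F₀ + loss v F₁)) (∑ₛ-∷ (λ A → shadow? (suc v) F A ▸ 1)) ⟩
  ∑ₛ (λ A → shadow? v F₀ A ▸ 1) + ∑ₛ (λ A → shadow? v F₁ A ▸ 1) + (loss v F₀ + loss v F₁)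
    ≡⟨ middle (∑ₛ (λ A → shadow? v F₀ A ▸ 1)) _ _ _ ⟩
  ∑ₛ (λ A → shadow? v F₀ A ▸ 1) + loss v F₀ + (∑ₛ (λ A → shadow? v F₁ A ▸ 1) + loss v F₁)
    ≡⟨ cong₂ _+_ (shadow+loss v F₀) (shadow+loss v F₁) ⟩
  count F₀ + count F₁
    ≡⟨ count-∷ F ⟨
  count F ∎
  where
  open ≡-Reasoning
  F₀ = F ∘ (outside ∷_)
  F₁ = F ∘ (inside ∷_)

v∉∁⁅v⁆ : (v : Fin n) → v ∉ ∁ ⁅ v ⁆
v∉∁⁅v⁆ v = x∈p⇒x∉∁p (x∈⁅x⁆ v)

∩∁≡ : {v : Fin n} {A : Subset n} → v ∉ A → A ∩ ∁ ⁅ v ⁆ ≡ A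
∩∁≡ {v = v} {A} v∉A = ⊆-antisym (p∩q⊆p A _) (λ x∈A → x∈p∩q⁺ (x∈A ,
  x∉p⇒x∈∁p (λ x∈v → v∉A (subst (_∈ A) (x∈⁅y⁆⇒x≡y v x∈v) x∈A))))

∪∩∁≡ : {v : Fin n} {A : Subset n} → v ∉ A → (A ∪ ⁅ v ⁆) ∩ ∁ ⁅ v ⁆ ≡ A
∪∩∁≡ {v = v} {A} v∉A = begin
  (A ∪ ⁅ v ⁆) ∩ ∁ ⁅ v ⁆              ≡⟨ ∩-distribʳ-∪ (∁ ⁅ v ⁆) A ⁅ v ⁆ ⟩
  (A ∩ ∁ ⁅ v ⁆) ∪ (⁅ v ⁆ ∩ ∁ ⁅ v ⁆)  ≡⟨ cong₂ _∪_ (∩∁≡ v∉A) (∩-inverseʳ ⁅ v ⁆) ⟩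
  A ∪ ⊥                              ≡⟨ ∪-identityʳ A ⟩
  A                                  ∎
  where open ≡-Reasoning

∩∁∪≡ : {v : Fin n} {H : Subset n} → v ∈ H → (H ∩ ∁ ⁅ v ⁆) ∪ ⁅ v ⁆ ≡ H
∩∁∪≡ {v = v} {H} v∈H = begin
  (H ∩ ∁ ⁅ v ⁆) ∪ ⁅ v ⁆              ≡⟨ ∪-distribʳ-∩ ⁅ v ⁆ H (∁ ⁅ v ⁆) ⟩
  (H ∪ ⁅ v ⁆) ∩ (∁ ⁅ v ⁆ ∪ ⁅ v ⁆)    ≡⟨ cong₂ _∩_ (⊆-antisym (∪-least ⊆-refl (⁅⁆⊆ v∈H)) (p⊆p∪q ⁅ v ⁆)) (∪-inverseˡ ⁅ v ⁆) ⟩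
  H ∩ ⊤                              ≡⟨ ∩-identityʳ H ⟩
  H                                  ∎
  where open ≡-Reasoning

trace+loss : (v : Fin n) (l : List (Subset n)) → Unique l →
  length (trace l (∁ ⁅ v ⁆)) + loss v (family l) ≡ length l
trace+loss {n} v l unique = begin
  length (trace l (∁ ⁅ v ⁆)) + loss v (family l)
    ≡⟨ cong (_+ loss v (family l)) (trans (length-deduplicate (map (_∩ ∁ ⁅ v ⁆) l))
         (∑-cong (subsets n) (λ A → ▸-cong (A ∈ˡ? map (_∩ ∁ ⁅ v ⁆) l) (shadow? v (family l) A) to from (λ _ → refl)))) ⟩
  ∑ₛ (λ A → shadow? v (family l) A ▸ 1) + loss v (family l)
    ≡⟨ shadow+loss v (family l) ⟩
  count (family l)
    ≡⟨ length≡count l unique ⟨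
  length l ∎
  where
  open ≡-Reasoning
  open DecMembership (_≟ₛ_ {n}) using () renaming (_∈?_ to _∈ˡ?_)
  to : ∀ {A} → A ∈ˡ map (_∩ ∁ ⁅ v ⁆) l → v ∉ A × (T (family l A) ⊎ T (family l (A ∪ ⁅ v ⁆)))
  to {A} i with ∈-map⁻ (_∩ ∁ ⁅ v ⁆) i
  ... | H , H∈l , refl = (λ v∈ → v∉∁⁅v⁆ v (proj₂ (x∈p∩q⁻ H _ v∈))) , by-cases (v ∈? H)
    where
    by-cases : Dec (v ∈ H) → T (family l (H ∩ ∁ ⁅ v ⁆)) ⊎ T (family l ((H ∩ ∁ ⁅ v ⁆) ∪ ⁅ v ⁆))
    by-cases (yes v∈H) = inj₂ (does-T (_ ∈ˡ? l) (subst (_∈ˡ l) (sym (∩∁∪≡ v∈H)) H∈l))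
    by-cases (no v∉H) = inj₁ (does-T (_ ∈ˡ? l) (subst (_∈ˡ l) (sym (∩∁≡ v∉H)) H∈l))
  from : ∀ {A} → v ∉ A × (T (family l A) ⊎ T (family l (A ∪ ⁅ v ⁆))) → A ∈ˡ map (_∩ ∁ ⁅ v ⁆) l
  from {A} (v∉A , inj₁ t) = subst (_∈ˡ _) (∩∁≡ v∉A) (∈-map⁺ (_∩ ∁ ⁅ v ⁆) (T-does (A ∈ˡ? l) t))
  from {A} (v∉A , inj₂ t) = subst (_∈ˡ _) (∪∩∁≡ v∉A) (∈-map⁺ (_∩ ∁ ⁅ v ⁆) (T-does ((A ∪ ⁅ v ⁆) ∈ˡ? l) t))

∁⊥≡⊤ : ∁ (⊥ {n}) ≡ ⊤
∁⊥≡⊤ {zero} = refl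
∁⊥≡⊤ {suc n} = cong (inside ∷_) ∁⊥≡⊤

co-singleton : (X : Subset (suc n)) → ∣ X ∣ ≡ n → ∃ λ v → X ≡ ∁ ⁅ v ⁆
co-singleton (outside ∷ X) eq = zero , cong (outside ∷_) (trans (∣p∣≡n⇒p≡⊤ eq) (sym ∁⊥≡⊤))
co-singleton {suc n} (inside ∷ X) eq = let v , eq′ = co-singleton X (suc-injective eq) in suc v , cong (inside ∷_) eq′

-- Lower bound for `m(n, s)`

good : ∀ {k e n} Q → 4 * suc e ≤ suc k → suc n ≡ Q * suc k → ∀ m → m ≤ Q * (2 ^ suc k ∸ suc e) →
  Good (suc n) (2 ^ k ∸ suc e) m
good {k} {e} {n} Q 4c≤d n≡ m m≤M l unique m≤l = find (Fin.any? (λ v → loss v F ≤? s))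
  where
  open ≤-Reasoning
  s t : ℕ
  s = 2 ^ k ∸ suc e
  t = 2 ^ suc k ∸ suc e
  l′ : List (Subset (suc n))
  -- The arrow admits more than `m` members. Keeping exactly `m` makes the size bound contradict
  -- `m ≤ Q * t`, and traces of the shorter list bound those of `l` from below.
  l′ = takeˡ m l
  unique′ : Unique l′
  unique′ = take⁺ m unique
  length-l′ : length l′ ≡ m
  length-l′ = trans (length-take m l) (m≤n⇒m⊓n≡m m≤l)
  F G : Family (suc n)
  F = family l′
  G = compress F
  find : Dec (∃ λ v → loss v F ≤ s) → ∃ λ X → ∣ X ∣ ≡ n × length (trace l X) ≥ m ∸ s
  find (yes (v , loss≤s)) = ∁ ⁅ v ⁆ , trans (∣∁p∣≡n∸∣p∣ ⁅ v ⁆) (cong (suc n ∸_) (∣⁅x⁆∣≡1 v)) , (begin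
    m ∸ s
      ≤⟨ ∸-monoʳ-≤ m loss≤s ⟩
    m ∸ loss v F
      ≡⟨ cong (_∸ loss v F) (trans (sym length-l′) (sym (trace+loss v l′ unique′))) ⟩
    length (trace l′ (∁ ⁅ v ⁆)) + loss v F ∸ loss v F
      ≡⟨ m+n∸n≡m (length (trace l′ (∁ ⁅ v ⁆))) (loss v F) ⟩
    length (trace l′ (∁ ⁅ v ⁆))
      ≤⟨ trace-take m l (∁ ⁅ v ⁆) ⟩
    length (trace l (∁ ⁅ v ⁆)) ∎)
  find (no none) = contradiction (*-cancelˡ-≤ (suc k) (begin
    suc k * suc (Q * t)          ≡⟨ lemma (suc k) Q t ⟩
    Q * suc k * t + suc k        ≡⟨ cong (λ x → x * t + suc k) n≡ ⟨
    suc n * t + suc k            ≤⟨ size-bound 4c≤d G (λ {A} {B} → compress-down F {A} {B}) ∅∈G min-degree ⟩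
    suc k * count G              ≡⟨ cong (suc k *_) (trans (count-compress F) (trans (sym (length≡count l′ unique′)) length-l′)) ⟩
    suc k * m                    ∎)) (<⇒≱ (s≤s m≤M))
    where
    lemma : ∀ d a t → d * suc (a * t) ≡ a * d * t + d
    lemma = solve-∀
    s<degree : ∀ v → s < degree G v
    s<degree v = <-≤-trans (≰⇒> (λ le → none (v , le))) (≤-trans (loss-compress v F)
      (≤-reflexive (loss-down v G (λ {A} {B} → compress-down F {A} {B}))))
    min-degree : ∀ v → 2 ^ k ≤ degree G v + e
    min-degree v = begin
      2 ^ k               ≤⟨ m≤n+m∸n (2 ^ k) (suc e) ⟩
      suc e + s           ≡⟨ cong suc (+-comm e s) ⟩
      suc s + e           ≤⟨ +-monoˡ-≤ e (s<degree v) ⟩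
      degree G v + e      ∎
    ∅∈G : T (G ⊥)
    ∅∈G with T? (G ⊥)
    ... | yes t = t
    ... | no ¬t = contradiction (≤-trans (s<degree zero) (≤-reflexive (trans
            (∑-cong (subsets (suc n)) (λ H → ▸-no (zero ∈? H ×-dec T? (G H))
              (λ (_ , H∈G) → ¬t (compress-down F {⊥} {H} ⊥⊆ H∈G)))) (∑-zero (subsets (suc n)))))) λ ()

-- The extremal family

-- The singletons of the first `e` vertices.
removed : ∀ d → ℕ → Family d
removed zero e [] = false
removed (suc d) zero H = false
removed (suc d) (suc e) (outside ∷ H) = removed d e H
removed (suc d) (suc e) (inside ∷ H) = does (H ≟ₛ ⊥)

count-removed : ∀ d e → e ≤ d → count (removed d e) ≡ e
count-removed zero zero _ = refl
count-removed (suc d) zero _ = ∑-zero (subsets (suc d))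
count-removed (suc d) (suc e) (s≤s e≤d) = begin
  count (removed (suc d) (suc e))                   ≡⟨ count-∷ (removed (suc d) (suc e)) ⟩
  count (removed d e) + ∑ₛ {d} (λ H → (H ≟ₛ ⊥) ▸ 1)     ≡⟨ cong₂ _+_ (count-removed d e e≤d) (∑ₛ-point (⊥ {d}) (λ _ → 1)) ⟩
  e + 1                                             ≡⟨ +-comm e 1 ⟩
  suc e                                             ∎
  where open ≡-Reasoning

removed-⊥ : ∀ d e → removed d e ⊥ ≡ false
removed-⊥ zero e = refl
removed-⊥ (suc d) zero = refl
removed-⊥ (suc d) (suc e) = removed-⊥ d e

count-full : ∀ n → ∑ₛ {n} (λ _ → 1) ≡ 2 ^ n
count-full zero = refl
count-full (suc n) = trans (∑ₛ-∷ {n} (λ _ → 1)) (cong₂ _+_ (count-full n) (trans (count-full n) (sym (+-identityʳ _))))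

∁ᶠ : Family n → Family n
∁ᶠ F A = not (F A)

count-∁ : (F : Family n) → count (∁ᶠ F) + count F ≡ 2 ^ n
count-∁ {n} F = trans (sym (∑-+ (subsets n) _ _))
  (trans (∑-cong (subsets n) (λ A → pointwise (F A))) (count-full n))
  where
  pointwise : ∀ a → (T? (not a) ▸ 1) + (T? a ▸ 1) ≡ 1
  pointwise true = refl
  pointwise false = refl

-- The full power set has `2 ^ n` pairs differing in `v` only, and removing a set destroys at most
-- one of them.
loss-∁ : (v : Fin (suc n)) (F : Family (suc n)) → 2 ^ n ≤ loss v (∁ᶠ F) + count F
loss-∁ {n} zero F = begin
  2 ^ n
    ≡⟨ count-full n ⟨
  ∑ₛ {n} (λ _ → 1)
    ≤⟨ ∑-mono (subsets n) (λ A → pointwise (F (outside ∷ A)) (F (inside ∷ A))) ⟩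
  ∑ₛ (λ A → (T? (not (F (outside ∷ A)) ∧ not (F (inside ∷ A))) ▸ 1) + ((T? (F (outside ∷ A)) ▸ 1) + (T? (F (inside ∷ A)) ▸ 1)))
    ≡⟨ trans (∑-+ (subsets n) _ _) (cong (loss zero (∁ᶠ F) +_) (trans (∑-+ (subsets n) _ _) (sym (count-∷ F)))) ⟩
  loss zero (∁ᶠ F) + count F ∎
  where
  open ≤-Reasoning
  pointwise : ∀ a b → 1 ≤ (T? (not a ∧ not b) ▸ 1) + ((T? a ▸ 1) + (T? b ▸ 1))
  pointwise true b = s≤s z≤n
  pointwise false true = s≤s z≤n
  pointwise false false = s≤s z≤n
loss-∁ {suc n} (suc v) F = begin
  2 ^ n + (2 ^ n + 0)
    ≡⟨ cong (2 ^ n +_) (+-identityʳ (2 ^ n)) ⟩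
  2 ^ n + 2 ^ n
    ≤⟨ +-mono-≤ (loss-∁ v (F ∘ (outside ∷_))) (loss-∁ v (F ∘ (inside ∷_))) ⟩
  loss v (∁ᶠ (F ∘ (outside ∷_))) + count (F ∘ (outside ∷_)) + (loss v (∁ᶠ (F ∘ (inside ∷_))) + count (F ∘ (inside ∷_)))
    ≡⟨ middle (loss v (∁ᶠ (F ∘ (outside ∷_)))) _ _ _ ⟩
  loss (suc v) (∁ᶠ F) + (count (F ∘ (outside ∷_)) + count (F ∘ (inside ∷_)))
    ≡⟨ cong (loss (suc v) (∁ᶠ F) +_) (count-∷ F) ⟨
  loss (suc v) (∁ᶠ F) + count F ∎
  where open ≤-Reasoning

module _ {m : ℕ} where

  ∑ₛ-++ : ∀ d (f : Subset (d + m) → ℕ) → ∑ₛ f ≡ ∑ₛ {d} (λ A → ∑ₛ {m} (λ B → f (A ++ᵛ B)))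
  ∑ₛ-++ zero f = sym (+-identityʳ _)
  ∑ₛ-++ (suc d) f = trans (∑ₛ-∷ f) (trans
    (cong₂ _+_ (∑ₛ-++ d (f ∘ (outside ∷_))) (∑ₛ-++ d (f ∘ (inside ∷_))))
    (sym (∑ₛ-∷ {d} (λ A → ∑ₛ {m} (λ B → f (A ++ᵛ B))))))

  loss-↑ˡ : ∀ {d} (v : Fin d) (F : Family (d + m)) → loss (v ↑ˡ m) F ≡ ∑ₛ {m} (λ B → loss v (λ A → F (A ++ᵛ B)))
  loss-↑ˡ {suc d} zero F = trans (∑ₛ-++ d (λ A → T? (F (outside ∷ A) ∧ F (inside ∷ A)) ▸ 1)) (∑-swap (subsets d) (subsets m) _)
  loss-↑ˡ (suc v) F = trans (cong₂ _+_ (loss-↑ˡ v (F ∘ (outside ∷_))) (loss-↑ˡ v (F ∘ (inside ∷_))))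
    (sym (∑-+ (subsets m) _ _))

  loss-↑ʳ : ∀ d (v : Fin m) (F : Family (d + m)) → loss (d ↑ʳ v) F ≡ ∑ₛ {d} (λ A → loss v (λ B → F (A ++ᵛ B)))
  loss-↑ʳ zero v F = sym (+-identityʳ _)
  loss-↑ʳ (suc d) v F = trans (cong₂ _+_ (loss-↑ʳ d v (F ∘ (outside ∷_))) (loss-↑ʳ d v (F ∘ (inside ∷_))))
    (sym (∑ₛ-∷ (λ A → loss v (λ B → F (A ++ᵛ B)))))

module Glue {d m : ℕ} (F : Family d) (F′ : Family m) (∅∈F : T (F ⊥)) (∅∈F′ : T (F′ ⊥)) where

  right? : ∀ (A : Subset d) (B : Subset m) → Dec (A ≡ ⊥ × T (F′ B))
  right? A B = (A ≟ₛ ⊥) ×-dec T? (F′ B)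

  left? : ∀ (A : Subset d) (B : Subset m) → Dec (B ≡ ⊥ × T (F A))
  left? A B = (B ≟ₛ ⊥) ×-dec T? (F A)

  glued? : ∀ (A : Subset d) (B : Subset m) → Dec ((A ≡ ⊥ × T (F′ B)) ⊎ (B ≡ ⊥ × T (F A)))
  glued? A B = right? A B ⊎-dec left? A B

  glue : Family (d + m)
  glue H = does (glued? (take d H) (drop d H))

  glue-++ : ∀ A B → glue (A ++ᵛ B) ≡ does (glued? A B)
  glue-++ A B = cong₂ (λ X Y → does (glued? X Y))
    (++-injectiveˡ (take d (A ++ᵛ B)) A (take++drop≡id d (A ++ᵛ B)))
    (++-injectiveʳ (take d (A ++ᵛ B)) A (take++drop≡id d (A ++ᵛ B)))

  -- The two blocks have exactly the empty set in common.
  count-glue : count glue + 1 ≡ count F′ + count F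
  count-glue = begin
    count glue + 1
      ≡⟨ cong₂ _+_ (trans (∑ₛ-++ d (λ H → T? (glue H) ▸ 1)) (∑-cong (subsets d) (λ A → ∑-cong (subsets m) (λ B →
           cong (λ b → T? b ▸ 1) (glue-++ A B))))) (sym both) ⟩
    ∑ₛ (λ A → ∑ₛ (λ B → glued? A B ▸ 1)) + ∑ₛ (λ A → ∑ₛ (λ B → (right? A B ×-dec left? A B) ▸ 1))
      ≡⟨ ∑∑-+ (λ A B → glued? A B ▸ 1) (λ A B → (right? A B ×-dec left? A B) ▸ 1) ⟨
    ∑ₛ (λ A → ∑ₛ (λ B → (glued? A B ▸ 1) + ((right? A B ×-dec left? A B) ▸ 1)))
      ≡⟨ ∑-cong (subsets d) (λ A → ∑-cong (subsets m) (λ B → pointwise (right? A B) (left? A B))) ⟩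
    ∑ₛ (λ A → ∑ₛ (λ B → (right? A B ▸ 1) + (left? A B ▸ 1)))
      ≡⟨ ∑∑-+ (λ A B → right? A B ▸ 1) (λ A B → left? A B ▸ 1) ⟩
    ∑ₛ (λ A → ∑ₛ (λ B → right? A B ▸ 1)) + ∑ₛ (λ A → ∑ₛ (λ B → left? A B ▸ 1))
      ≡⟨ cong₂ _+_ (product (λ A B → right? A B ▸ 1) (λ B → T? (F′ B) ▸ 1)
             (λ A B → sym (▸-× (A ≟ₛ ⊥) (T? (F′ B)))))
           (trans (∑-swap (subsets d) (subsets m) _) (product (λ B A → left? A B ▸ 1) (λ A → T? (F A) ▸ 1)
             (λ B A → sym (▸-× (B ≟ₛ ⊥) (T? (F A)))))) ⟩
    count F′ + count F ∎
    where
    open ≡-Reasoning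
    ∑∑-+ : ∀ (f g : Subset d → Subset m → ℕ) →
      ∑ₛ (λ A → ∑ₛ (λ B → f A B + g A B)) ≡ ∑ₛ (λ A → ∑ₛ (f A)) + ∑ₛ (λ A → ∑ₛ (g A))
    ∑∑-+ f g = trans (∑-cong (subsets d) (λ A → ∑-+ (subsets m) (f A) (g A))) (∑-+ (subsets d) _ _)
    product : ∀ {a b} (f : Subset a → Subset b → ℕ) (g : Subset b → ℕ) →
      (∀ A B → f A B ≡ (A ≟ₛ ⊥) ▸ g B) → ∑ₛ (λ A → ∑ₛ (f A)) ≡ ∑ₛ g
    product {a} {b} f g eq = trans (∑-cong (subsets a) (λ A → trans (∑-cong (subsets b) (eq A))
      (∑-▸ (subsets b) (A ≟ₛ ⊥) g))) (∑ₛ-point (⊥ {a}) (λ _ → ∑ₛ g))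
    pointwise : ∀ {P Q : Set} (p : Dec P) (q : Dec Q) →
      ((p ⊎-dec q) ▸ 1) + ((p ×-dec q) ▸ 1) ≡ (p ▸ 1) + (q ▸ 1)
    pointwise (yes _) (yes _) = refl
    pointwise (yes _) (no _) = refl
    pointwise (no _) (yes _) = refl
    pointwise (no _) (no _) = refl
    both : ∑ₛ (λ A → ∑ₛ (λ B → (right? A B ×-dec left? A B) ▸ 1)) ≡ 1
    both = trans (product (λ A B → (right? A B ×-dec left? A B) ▸ 1) (λ B → (B ≟ₛ ⊥) ▸ 1)
      (λ A B → trans (▸-cong (right? A B ×-dec left? A B) ((A ≟ₛ ⊥) ×-dec (B ≟ₛ ⊥))
        (λ ((a , _) , b , _) → a , b) (λ { (refl , refl) → (refl , ∅∈F′) , refl , ∅∈F }) (λ _ → refl))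
        (sym (▸-× (A ≟ₛ ⊥) (B ≟ₛ ⊥))))) (∑ₛ-point (⊥ {m}) (λ _ → 1))

  glue-⊥ : T (glue ⊥)
  glue-⊥ = subst (T ∘ glue) (⊥++⊥ d) (subst T (sym (glue-++ ⊥ ⊥)) (does-T (glued? ⊥ ⊥) (inj₂ (refl , ∅∈F))))
    where
    ⊥++⊥ : ∀ d → ⊥ {d} ++ᵛ ⊥ {m} ≡ ⊥
    ⊥++⊥ zero = refl
    ⊥++⊥ (suc d) = cong (outside ∷_) (⊥++⊥ d)

  loss-left : ∀ v → loss v F ≤ loss (v ↑ˡ m) glue
  loss-left v = begin
    loss v F                                     ≤⟨ loss-mono v (λ A t → subst T (sym (glue-++ A ⊥)) (does-T (glued? A ⊥) (inj₂ (refl , t)))) ⟩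
    loss v (λ A → glue (A ++ᵛ ⊥))                ≤⟨ ∑-∈ (λ B → loss v (λ A → glue (A ++ᵛ B))) (∈-subsets ⊥) ⟩
    ∑ₛ (λ B → loss v (λ A → glue (A ++ᵛ B)))     ≡⟨ loss-↑ˡ v glue ⟨
    loss (v ↑ˡ m) glue                           ∎
    where open ≤-Reasoning

  loss-right : ∀ v → loss v F′ ≤ loss (d ↑ʳ v) glue
  loss-right v = begin
    loss v F′                                    ≤⟨ loss-mono v (λ B t → subst T (sym (glue-++ ⊥ B)) (does-T (glued? ⊥ B) (inj₁ (refl , t)))) ⟩
    loss v (λ B → glue (⊥ ++ᵛ B))                ≤⟨ ∑-∈ (λ A → loss v (λ B → glue (A ++ᵛ B))) (∈-subsets ⊥) ⟩
    ∑ₛ (λ A → loss v (λ B → glue (A ++ᵛ B)))     ≡⟨ loss-↑ʳ d v glue ⟨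
    loss (d ↑ʳ v) glue                           ∎
    where open ≤-Reasoning

module _ {k e : ℕ} (e≤k : e ≤ k) where

  block : Family (suc k)
  block = ∁ᶠ (removed (suc k) e)

  block-⊥ : T (block ⊥)
  block-⊥ = subst (T ∘ not) (sym (removed-⊥ (suc k) e)) tt

  -- Written as a successor because gluing identifies the empty sets: `Q` blocks then have
  -- `Q * (2 ^ suc k ∸ suc e)` nonempty members and one empty set.
  count-block : count block ≡ suc (2 ^ suc k ∸ suc e)
  count-block = trans (sym (m+n∸n≡m (count block) e)) (trans
    (cong (_∸ e) (trans (cong (count block +_) (sym (count-removed (suc k) e (m≤n⇒m≤1+n e≤k)))) (count-∁ (removed (suc k) e))))
    (+-∸-assoc 1 {2 ^ suc k} {suc e} (≤-trans (s≤s e≤k) (≤-trans (n<2^n k) (m≤m+n (2 ^ k) _)))))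

  loss-block : ∀ v → 2 ^ k ≤ loss v block + e
  loss-block v = ≤-trans (loss-∁ v (removed (suc k) e))
    (≤-reflexive (cong (loss v block +_) (count-removed (suc k) e (m≤n⇒m≤1+n e≤k))))

  packing : ∀ Q → ∃ λ (F : Family (Q * suc k)) →
    T (F ⊥) × count F ≡ suc (Q * (2 ^ suc k ∸ suc e)) × (∀ v → 2 ^ k ≤ loss v F + e)
  -- On no vertices the family consists of the empty set alone; this is the member by which the
  -- packing exceeds the bound.
  packing zero = (λ _ → true) , tt , refl , λ ()
  packing (suc Q) = let F , ∅∈F , count-F , loss-F = packing Q
                        open Glue block F block-⊥ ∅∈F in
    glue , glue-⊥ ,
    suc-injective (trans (+-comm 1 (count glue)) (trans count-glue (trans (cong₂ _+_ count-F count-block)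
      (lemma (Q * (2 ^ suc k ∸ suc e)) (2 ^ suc k ∸ suc e))))) ,
    λ v → large v (splitAt (suc k) v) refl loss-left loss-right loss-F
    where
    lemma : ∀ a b → suc a + suc b ≡ suc (suc (b + a))
    lemma = solve-∀
    large : ∀ {m F} {F′ : Family (suc k + m)} v (x : Fin (suc k) ⊎ Fin m) → splitAt (suc k) v ≡ x →
      (∀ v → loss v block ≤ loss (v ↑ˡ m) F′) → (∀ v → loss v F ≤ loss (suc k ↑ʳ v) F′) →
      (∀ v → 2 ^ k ≤ loss v F + e) → 2 ^ k ≤ loss v F′ + e
    large {F′ = F′} v (inj₁ i) eq left right loss-F = ≤-trans (loss-block i) (+-monoˡ-≤ e
      (≤-trans (left i) (≤-reflexive (cong (λ x → loss x F′) (Fin.splitAt⁻¹-↑ˡ {i = v} eq)))))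
    large {F′ = F′} v (inj₂ i) eq left right loss-F = ≤-trans (loss-F i) (+-monoˡ-≤ e
      (≤-trans (right i) (≤-reflexive (cong (λ x → loss x F′) (Fin.splitAt⁻¹-↑ʳ {i = v} eq)))))

  -- Deleting any vertex from the packing loses at least `2 ^ k - e = s + 1` members, and every
  -- `n`-element subset of the ground set is the complement of one vertex.
  not-good : ∀ {n} Q → suc n ≡ Q * suc k → ¬ Good (suc n) (2 ^ k ∸ suc e) (suc (Q * (2 ^ suc k ∸ suc e)))
  not-good {n} Q eq g with subst (λ x → ∃ λ (F : Family x) →
    T (F ⊥) × count F ≡ suc (Q * (2 ^ suc k ∸ suc e)) × (∀ v → 2 ^ k ≤ loss v F + e)) (sym eq) (packing Q)
  ... | F , _ , count-F , loss-F with g (toList F) (toList-unique F) (≤-reflexive (sym (trans (length-toList F) count-F)))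
  ...   | X , ∣X∣≡n , large with co-singleton X ∣X∣≡n
  ...     | v , refl = contradiction (begin-strict
    suc M
      ≤⟨ m∸n≤o⇒m≤n+o′ large ⟩
    s + length (trace (toList F) X)
      <⟨ +-monoˡ-< (length (trace (toList F) X)) s<loss ⟩
    loss v F + length (trace (toList F) X)
      ≤⟨ +-monoˡ-≤ (length (trace (toList F) X)) (loss-mono v (⊆-toList F)) ⟩
    loss v (family (toList F)) + length (trace (toList F) X)
      ≡⟨ trans (+-comm (loss v (family (toList F))) _) (trans (trace+loss v (toList F) (toList-unique F))
           (trans (length-toList F) count-F)) ⟩
    suc M ∎) (<-irrefl refl)
    where
    open ≤-Reasoning
    s M : ℕ
    s = 2 ^ k ∸ suc e
    M = Q * (2 ^ suc k ∸ suc e)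
    m∸n≤o⇒m≤n+o′ : ∀ {m n o} → m ∸ n ≤ o → m ≤ n + o
    m∸n≤o⇒m≤n+o′ {m} {n} le = ≤-trans (m≤n+m∸n m n) (+-monoʳ-≤ n le)
    s<loss : s < loss v F
    s<loss = +-cancelʳ-≤ e _ _ (begin
      suc s + e              ≡⟨ cong suc (+-comm s e) ⟩
      suc e + s              ≡⟨ m+[n∸m]≡n (≤-trans (s≤s e≤k) (n<2^n k)) ⟩
      2 ^ k                  ≤⟨ loss-F v ⟩
      loss v F + e           ∎)

mainTheorem1 : (d c n : ℕ) → (d>0 : 1 ≤ d) → 1 ≤ c → 1 ≤ n → 4 * c ≤ d → d ∣ n →
    IsMNS n (2 ^ (d ∸ 1) ∸ c) (((n / d) {{>-nonZero d>0}}) * (2 ^ d ∸ c))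
mainTheorem1 (suc k) (suc e) (suc n) d>0 1≤c 1≤n 4c≤d (divides Q eq) =
  subst (λ x → IsMNS (suc n) (2 ^ k ∸ suc e) (x * (2 ^ suc k ∸ suc e)))
    (sym (trans (cong (_/ suc k) eq) (m*n/n≡m Q (suc k))))
    (good Q 4c≤d eq , λ h → not-good e≤k Q eq (h _ ≤-refl))
  where
  e≤k : e ≤ k
  e≤k = ≤-trans (m≤n*m e 4) (s≤s⁻¹ (≤-trans (≤-trans (m≤m+n (suc (4 * e)) 3) (≤-reflexive (lemma e))) 4c≤d))
    where
    lemma : ∀ e → suc (4 * e) + 3 ≡ 4 * suc e
    lemma = solve-∀
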